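{- Any $n$-vertex graph of treewidth $\tau\ge 1$ has a voxel representation of size $O(n\tau)$. That is, there is an absolute constant $C>0$ such that for all integers $n,\tau\ge 1$, every graph with $n$ vertices and treewidth $\tau$ has a voxel representation of size at most $C\,n\,\tau$.
   Context: All graphs are finite and simple. A voxel is a cell of the unit cube grid in 3-dimensional space; two distinct voxels are adjacent if they share a face. A blob is a nonempty finite set of voxels that is connected with respect to this adjacency. A voxel representation of a graph $G=(V,E)$ assigns to each vertex $v\in V$ a blob $B_v$ such that the blobs of distinct vertices are disjoint and, for all distinct $u,v\in V$, some voxel of $B_u$ is adjacent to some voxel of $B_v$ if and only if $uv\in E$. Its size is $\sum_{v\in V}|B_v|$. Treewidth is the usual notion: the minimum, over all tree decompositions, of the maximum bag size minus $1$. -}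

module Defs where

open import Data.Fin.Base using (Fin)
open import Data.Fin.Subset using (Subset; ∣_∣) renaming (_∈_ to _∈ₛ_)
open import Data.Integer.Base as ℤ using (ℤ)
open import Data.List.Base using (List; _∷_; _∷ʳ_; length; tabulate)
open import Data.List.Extrema.Nat using (max)
open import Data.List.Membership.Propositional using (_∈_)
open import Data.List.Relation.Binary.Disjoint.Propositional using (Disjoint)
open import Data.List.Relation.Unary.Linked using (Linked)
open import Data.List.Relation.Unary.Unique.Propositional using (Unique)
open import Data.Nat.Base using (ℕ; NonZero; pred; _≤_)
open import Data.Nat.ListAction using (sum)
open import Data.Product.Base using (Σ; ∃; ∃₂; _×_)
open import Data.Vec.Base using (Vec; updateAt)
open import Function.Bundles using (_⇔_)
open import Level using (Level; 0ℓ; _⊔_)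
open import Relation.Binary.Core using (Rel)
open import Relation.Binary.Construct.Closure.ReflexiveTransitive using (Star)
open import Relation.Binary.Definitions using (Decidable; Irreflexive; Symmetric)
open import Relation.Binary.PropositionalEquality.Core using (_≡_; _≢_)
open import Relation.Nullary.Negation.Core using (¬_)
open import Relation.Unary using (Pred; U)

-- Any two points of P are joined by an R-walk that stays inside P.
-- The empty set counts as connected; nonemptiness is demanded separately.

ConnectedIn : {a p r : Level} {A : Set a} → Rel A r → Pred A p → Set (a ⊔ p ⊔ r)
ConnectedIn R P = ∀ {x y} → P x → P y → Star (λ s t → P s × P t × R s t) x y

record Graph (n : ℕ) : Set₁ where
  field
    Adj         : Rel (Fin n) 0ℓ
    irreflexive : Irreflexive _≡_ Adj
    symmetric   : Symmetric Adj
    adj?        : Decidable Adj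

open Graph public using (Adj)

-- u , v , vs … , w are the vertices, in cyclic order, of a cycle of length
-- at least three.

Acyclic : ∀ {n} → Graph n → Set
Acyclic G = ∀ u v vs w →
  Unique (u ∷ v ∷ vs ∷ʳ w) → Linked (Adj G) (u ∷ v ∷ vs ∷ʳ w) → ¬ Adj G w u

record IsTree {m : ℕ} (T : Graph m) : Set where
  field
    nonEmpty  : NonZero m
    connected : ConnectedIn (Adj T) U
    acyclic   : Acyclic T

record TreeDecomposition {n : ℕ} (G : Graph n) : Set₁ where
  field
    nodes           : ℕ
    tree            : Graph nodes
    isTree          : IsTree tree
    bag             : Fin nodes → Subset n
    coversVertices  : ∀ v → ∃ λ t → v ∈ₛ bag t
    coversEdges     : ∀ {u v} → Adj G u v → ∃ λ t → u ∈ₛ bag t × v ∈ₛ bag t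
    connectedTraces : ∀ v → ConnectedIn (Adj tree) (λ t → v ∈ₛ bag t)

  -- For n ≥ 1 some bag is nonempty, so pred never truncates.
  width : ℕ
  width = pred (max 0 (tabulate (λ t → ∣ bag t ∣)))

open TreeDecomposition public using (width)

record HasTreewidth {n : ℕ} (G : Graph n) (τ : ℕ) : Set₁ where
  field
    attained : Σ (TreeDecomposition G) λ D → width D ≡ τ
    minimal  : (D : TreeDecomposition G) → τ ≤ width D

-- The voxel p is the cell [p₀ , p₀ + 1] × [p₁ , p₁ + 1] × [p₂ , p₂ + 1].

Voxel : Set
Voxel = Vec ℤ 3

shift : Fin 3 → Voxel → Voxel
shift i p = updateAt p i ℤ.suc

-- face i p is the unit square of the grid orthogonal to axis i whose
-- least corner is p.

data Face : Set where
  face : Fin 3 → Vec ℤ 3 → Face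

data _IsFaceOf_ : Face → Voxel → Set where
  lower : ∀ i p → face i p IsFaceOf p
  upper : ∀ i p → face i (shift i p) IsFaceOf p

Adjacent : Rel Voxel 0ℓ
Adjacent p q = p ≢ q × ∃ λ f → f IsFaceOf p × f IsFaceOf q

record Blob : Set where
  field
    voxels    : List Voxel
    unique    : Unique voxels
    nonEmpty  : ∃ λ p → p ∈ voxels
    connected : ConnectedIn Adjacent (_∈ voxels)

open Blob public using (voxels)

Touching : Rel Blob 0ℓ
Touching B B′ = ∃₂ λ p q → p ∈ voxels B × q ∈ voxels B′ × Adjacent p q

record VoxelRepresentation {n : ℕ} (G : Graph n) : Set where
  field
    blob     : Fin n → Blob
    disjoint : ∀ {u v} → u ≢ v → Disjoint (voxels (blob u)) (voxels (blob v))
    contact  : ∀ {u v} → u ≢ v → Touching (blob u) (blob v) ⇔ Adj G u v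

  size : ℕ
  size = sum (tabulate (λ v → length (voxels (blob v))))

open VoxelRepresentation public using (size)

{-# OPTIONS --safe #-}
module Submission where

-- A graph of treewidth τ is a minor of the grid ℕ³ with branch sets of total size O(nτ);
-- doubling the grid then turns branch sets into blobs with exactly the prescribed contacts.
--
-- To find the minor, grow the tree of the decomposition from a root, so that every new bag meets
-- the earlier ones inside its parent's bag, and cut the resulting rooted tree into O(n/τ) chunks
-- of O(τ) vertices.  Contract the tree of chunks repeatedly: each round merges at most 63 units
-- and divides their number by 16, and a unit shares at most 3(τ+1) vertices with the outside.
-- A chunk is drawn as a crossbar of size O(τ²).  A unit of level k is drawn in a two-layer
-- rectangle of side O(8ᵏτ), because 63 ≤ 8² and the units are stacked alternately along the two
-- axes; its wiring has size O(8ᵏτ²).  Since 8 < 16, the sizes form a geometric series with sum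
-- O((n/τ) τ²).

open import Defs
open import Algebra.Properties.CommutativeSemigroup using (interchange; x∙yz≈y∙xz)
open import Data.Bool.Base using (Bool; true; false; not; if_then_else_)
open import Data.Bool.Properties using (not-involutive)
open import Data.Empty using (⊥; ⊥-elim)
open import Data.Fin.Base as Fin using (Fin; zero; suc; toℕ)
import Data.Fin.Properties as Fin
open import Data.Fin.Subset using (Subset; ∣_∣) renaming (_∈_ to _∈ₛ_)
open import Data.Fin.Subset.Properties using (∣p∣≤n)
open import Data.Integer.Base as ℤ using () renaming (+_ to pos)
import Data.Integer.Properties as ℤ
open import Data.List.Base using (List; []; _∷_; _++_; _∷ʳ_; map; concatMap; filter; length; lookup; allFin; upTo; tabulate; deduplicate; cartesianProductWith)
open import Data.List.Extrema.Nat using (max; xs≤max; max≤v⁺)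
import Data.List.Membership.DecPropositional as DecMembership
open import Data.List.Membership.Propositional using (_∈_; _∉_; find; lose)
open import Data.List.Membership.Propositional.Properties
import Data.List.Properties as List
open import Data.List.Relation.Binary.Subset.Propositional using (_⊆_)
open import Data.List.Relation.Unary.All as All using (All; []; _∷_)
import Data.List.Relation.Unary.All.Properties as All
open import Data.List.Relation.Unary.AllPairs using (AllPairs; []; _∷_)
import Data.List.Relation.Unary.AllPairs.Properties as AllPairs
open import Data.List.Relation.Unary.Any as Any using (Any; here; there)
import Data.List.Relation.Unary.Any.Properties as Any
open import Data.List.Relation.Unary.Linked as Linked using (Linked; [-]; _∷_)
open import Data.List.Relation.Unary.Unique.Propositional using (Unique)
import Data.List.Relation.Unary.Unique.DecPropositional.Properties as UniqueDec
import Data.List.Relation.Unary.Unique.Propositional.Properties as Unique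
open import Data.Nat.Base
open import Data.Nat.ListAction using (sum)
open import Data.Nat.Properties
open import Data.Nat.Tactic.RingSolver using (solve-∀)
open import Data.Product.Base using (Σ; ∃; ∃₂; _×_; _,_; proj₁; proj₂; map₁)
open import Data.Sum.Base as Sum using (_⊎_; inj₁; inj₂)
open import Data.Unit.Base using (⊤; tt)
open import Data.Vec.Base as Vec using (Vec; []; _∷_; updateAt)
import Data.Vec.Properties as Vec
open import Function.Base using (_∘_; id)
open import Function.Bundles using (mk⇔)
open import Relation.Binary.Construct.Closure.ReflexiveTransitive as Star using (Star; ε; _◅_; _◅◅_)
open import Relation.Binary.Definitions using (DecidableEquality)
open import Relation.Binary.PropositionalEquality
open import Relation.Nullary

-- A decomposition may have far more bags than `n`, so bags cannot be counted. The weight of a bag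
-- is the number of vertices that it introduces, those absent from its parent. Each vertex is
-- introduced at most once, so the total weight is at most `n`. A chunk may consist of many light
-- bags and still has few vertices, since each of them is introduced inside the chunk or lies in the
-- adhesion at its top. The wiring of a unit must not grow with the number of vertices inside it.
-- Hence the demand that a vertex common to two units of a cluster be a port of both: at most `W`
-- tracks then connect the children, and every other vertex stays inside one child. Stacking always
-- in the same direction would lengthen the wires by a factor of about 63 per round, more than the
-- factor 16 gained by contraction. Alternating the axes spreads this growth over two rounds, a
-- factor of 8 each.

-- Rooted binary trees with adhesions

module Trees (V : Set) (K : ℕ) where

  -- A node carries the adhesion of its edge to the parent.
  data Tree (X : Set) : Set where
    nil  : Tree X
    node : List V → X → Tree X → Tree X → Tree X

  top : ∀ {X} → Tree X → List V
  top nil            = []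
  top (node S _ _ _) = S

  count : ∀ {X} → Tree X → ℕ
  count nil            = 0
  count (node _ _ l r) = suc (count l + count r)

  weigh : ∀ {X} → (X → ℕ) → Tree X → ℕ
  weigh w nil            = 0
  weigh w (node _ x l r) = w x + (weigh w l + weigh w r)

  data AnyT {X : Set} (Q : X → Set) : Tree X → Set where
    here  : ∀ {S x l r} → Q x → AnyT Q (node S x l r)
    left  : ∀ {S x l r} → AnyT Q l → AnyT Q (node S x l r)
    right : ∀ {S x l r} → AnyT Q r → AnyT Q (node S x l r)

  mapAnyT : ∀ {X : Set} {P Q : X → Set} → (∀ {x} → P x → Q x) → ∀ {t} → AnyT P t → AnyT Q t
  mapAnyT f (here p)  = here (f p)
  mapAnyT f (left a)  = left (mapAnyT f a)
  mapAnyT f (right a) = right (mapAnyT f a)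

  data AllT {X : Set} (Q : List V → X → Set) : Tree X → Set where
    nil  : AllT Q nil
    node : ∀ {S x l r} → Q S x → AllT Q l → AllT Q r → AllT Q (node S x l r)

  mapAllT : ∀ {X : Set} {P Q : List V → X → Set} → (∀ {S x} → P S x → Q S x) → ∀ {t} → AllT P t → AllT Q t
  mapAllT f nil          = nil
  mapAllT f (node p l r) = node (f p) (mapAllT f l) (mapAllT f r)

  zipAllT : ∀ {X : Set} {P Q R : List V → X → Set} → (∀ {S x} → P S x → Q S x → R S x) →
            ∀ {t} → AllT P t → AllT Q t → AllT R t
  zipAllT f nil          nil             = nil
  zipAllT f (node p l r) (node q l′ r′) = node (f p q) (zipAllT f l l′) (zipAllT f r r′)

  weigh-1 : ∀ {X : Set} (t : Tree X) → weigh (λ _ → 1) t ≡ count t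
  weigh-1 nil            = refl
  weigh-1 (node _ _ l r) = cong suc (cong₂ _+_ (weigh-1 l) (weigh-1 r))

  weigh-bound : ∀ {X : Set} {f g : X → ℕ} c {t} → AllT (λ _ x → f x ≤ c + g x) t →
                weigh f t ≤ count t * c + weigh g t
  weigh-bound c nil = z≤n
  weigh-bound {f = f} {g} c {node _ x l r} (node p pl pr) = begin
    f x + (weigh f l + weigh f r)
      ≤⟨ +-mono-≤ p (+-mono-≤ (weigh-bound c pl) (weigh-bound c pr)) ⟩
    c + g x + (count l * c + weigh g l + (count r * c + weigh g r))
      ≡⟨ regroup c (g x) (count l) (weigh g l) (count r) (weigh g r) ⟩
    suc (count l + count r) * c + (g x + (weigh g l + weigh g r)) ∎
    where
    open ≤-Reasoning
    regroup : ∀ c x m a n b → c + x + (m * c + a + (n * c + b)) ≡ suc (m + n) * c + (x + (a + b))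
    regroup = solve-∀

  module _ {X : Set} (Occ : V → X → Set) (tr : X → List V) where

    -- `tr x` lists the vertices that `x` can hand on to its neighbours. Adhesions are required to
    -- lie in it because they become ports, and a port must be reachable at the margin of the
    -- drawing of `x`.
    record Joint (O : V → Set) (S : List V) (x : X) (l r : Tree X) : Set where
      field
        small     : length S ≤ K
        separates : ∀ {v} → O v → AnyT (Occ v) (node S x l r) → v ∈ S
        top⊆      : S ⊆ tr x
        left⊆     : top l ⊆ tr x
        right⊆    : top r ⊆ tr x

    -- O is what occurs outside the subtree; meeting it only in the top is the axiom of tree decompositions.
    Separated : (V → Set) → Tree X → Set
    Separated O nil            = ⊤
    Separated O (node S x l r) =
      Joint O S x l r ×
      Separated (λ v → O v ⊎ Occ v x ⊎ AnyT (Occ v) r) l ×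
      Separated (λ v → O v ⊎ Occ v x ⊎ AnyT (Occ v) l) r

    separated-mono : ∀ {O O′ : V → Set} t → (∀ {v} → O′ v → AnyT (Occ v) t → O v) →
                     Separated O t → Separated O′ t
    separated-mono nil f tt = tt
    separated-mono (node S x l r) f (j , sl , sr) =
      record { Joint j hiding (separates) ; separates = λ o any → Joint.separates j (f o any) any } ,
      separated-mono l (λ { (inj₁ o) any → inj₁ (f o (left any)) ; (inj₂ o) any → inj₂ o }) sl ,
      separated-mono r (λ { (inj₁ o) any → inj₁ (f o (right any)) ; (inj₂ o) any → inj₂ o }) sr

    separated-top : ∀ {O : V → Set} t → Separated O t → ∀ {v} → O v → AnyT (Occ v) t → v ∈ top t
    separated-top (node S x l r) (j , _) = Joint.separates j

    top-small : ∀ {O : V → Set} t → Separated O t → length (top t) ≤ K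
    top-small nil            _       = z≤n
    top-small (node S x l r) (j , _) = Joint.small j

    separated-small : ∀ {O} t → Separated O t → AllT (λ S _ → length S ≤ K) t
    separated-small nil            _             = nil
    separated-small (node S x l r) (j , sl , sr) = node (Joint.small j) (separated-small l sl) (separated-small r sr)

  -- Serves to replace a cluster of bags by the plain list of its vertices. The map `f` also
  -- receives the adhesion, because some vertices of a chunk come from there.
  module Relabelling {X Y : Set} (Occ : V → X → Set) (tr : X → List V) (Occ′ : V → Y → Set) (tr′ : Y → List V)
           (f : List V → X → Y) where

    mapT : Tree X → Tree Y
    mapT nil            = nil
    mapT (node S x l r) = node S (f S x) (mapT l) (mapT r)

    top-mapT : ∀ t → top (mapT t) ≡ top t
    top-mapT nil            = refl
    top-mapT (node _ _ _ _) = refl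

    count-mapT : ∀ t → count (mapT t) ≡ count t
    count-mapT nil            = refl
    count-mapT (node _ _ l r) = cong suc (cong₂ _+_ (count-mapT l) (count-mapT r))

    all-mapT : ∀ {Q : List V → Y → Set} {t} → AllT (λ S x → Q S (f S x)) t → AllT Q (mapT t)
    all-mapT nil          = nil
    all-mapT (node q l r) = node q (all-mapT l) (all-mapT r)

    any-mapT⁺ : ∀ {P : X → Set} {Q : Y → Set} {t} → AllT (λ S x → P x → Q (f S x)) t → AnyT P t → AnyT Q (mapT t)
    any-mapT⁺ (node p l r) (here q)  = here (p q)
    any-mapT⁺ (node p l r) (left a)  = left (any-mapT⁺ l a)
    any-mapT⁺ (node p l r) (right a) = right (any-mapT⁺ r a)

    record Faithful (S : List V) (x : X) : Set where
      field
        occ⁺ : ∀ {v} → Occ v x → Occ′ v (f S x)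
        occ⁻ : ∀ {v} → Occ′ v (f S x) → Occ v x
        tr⊆  : tr x ⊆ tr′ (f S x)

    any-mapT⁻ : ∀ {t v} → AllT Faithful t → AnyT (Occ′ v) (mapT t) → AnyT (Occ v) t
    any-mapT⁻ (node p l r) (here q)  = here (Faithful.occ⁻ p q)
    any-mapT⁻ (node p l r) (left a)  = left (any-mapT⁻ l a)
    any-mapT⁻ (node p l r) (right a) = right (any-mapT⁻ r a)

    separated-mapT : ∀ {O t} → AllT Faithful t → Separated Occ tr O t → Separated Occ′ tr′ O (mapT t)
    separated-mapT nil tt = tt
    separated-mapT {t = node S x l r} ps@(node p pl pr) (j , sl , sr) =
      record { small     = small
             ; separates = λ o a → separates o (any-mapT⁻ ps a)
             ; top⊆      = tr⊆ ∘ top⊆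
             ; left⊆     = λ {v} v∈ → tr⊆ (left⊆ (subst (v ∈_) (top-mapT l) v∈))
             ; right⊆    = λ {v} v∈ → tr⊆ (right⊆ (subst (v ∈_) (top-mapT r) v∈)) } ,
      separated-mono Occ′ tr′ (mapT l) (λ o _ → Sum.map₂ (Sum.map occ⁻ (any-mapT⁻ pr)) o) (separated-mapT pl sl) ,
      separated-mono Occ′ tr′ (mapT r) (λ o _ → Sum.map₂ (Sum.map occ⁻ (any-mapT⁻ pl)) o) (separated-mapT pr sr)
      where
      open Joint j
      open Faithful p

  -- Contraction of a tree into clusters of bounded weight

  module Contraction {X : Set} (Occ : V → X → Set) (tr : X → List V) (w : X → ℕ) (b : ℕ) where

    Items : Set
    Items = List (X × List V)

    OccI : V → Items → Set
    OccI v = Any (λ y → Occ v (proj₁ y))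

    ports : Items → List V
    ports = concatMap proj₂

    sumI : (X → ℕ) → Items → ℕ
    sumI f I = sum (map (λ y → f (proj₁ y)) I)

    wI : Items → ℕ
    wI = sumI w

    -- Drawings of different items are joined only through their ports, so a vertex that is common
    -- to two items has to be a port of both.
    Coherent : X × List V → X × List V → Set
    Coherent (x , P) (y , Q) = ∀ v → Occ v x → Occ v y → v ∈ P × v ∈ Q

    Good : Items → Set
    Good I = All (λ y → proj₂ y ⊆ tr (proj₁ y) × length (proj₂ y) ≤ 3 * K) I × AllPairs Coherent I

    -- The ports face the parent and the two children, one adhesion each; this is the origin of the
    -- bound `3 * K`.
    item : List V → X → Tree X → Tree X → X × List V
    item S x l r = x , S ++ top l ++ top r

    -- Contracts t I t′: the subtree t becomes an unfinished cluster I on top of the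
    -- finished clusters t′.  A cluster is finished once its weight exceeds b, or when
    -- finished clusters hang below it on both sides.
    data Contracts : Tree X → Items → Tree Items → Set where
      nil    : Contracts nil [] nil
      closed : ∀ {S x l r I J t u} → Contracts l I t → Contracts r J u →
               (0 < count t × 0 < count u) ⊎ b < wI (item S x l r ∷ I ++ J) →
               Contracts (node S x l r) [] (node S (item S x l r ∷ I ++ J) t u)
      openˡ  : ∀ {S x l r I J t} → Contracts l I t → Contracts r J nil →
               wI (item S x l r ∷ I ++ J) ≤ b →
               Contracts (node S x l r) (item S x l r ∷ I ++ J) t
      openʳ  : ∀ {S x l r I J u} → Contracts l I nil → Contracts r J u →
               wI (item S x l r ∷ I ++ J) ≤ b →
               Contracts (node S x l r) (item S x l r ∷ I ++ J) u

    contract : ∀ t → ∃₂ (Contracts t)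
    contract nil = _ , _ , nil
    contract (node S x l r) with contract l | contract r
    ... | I , t , c | J , u , d with wI (item S x l r ∷ I ++ J) ≤? b
    ...   | no  big = _ , _ , closed c d (inj₂ (≰⇒> big))
    contract (node S x l r) | I , nil , c | J , u , d | yes small = _ , _ , openʳ c d small
    contract (node S x l r) | I , t@(node _ _ _ _) , c | J , nil , d | yes small = _ , _ , openˡ c d small
    contract (node S x l r) | I , node _ _ _ _ , c | J , node _ _ _ _ , d | yes small =
      _ , _ , closed c d (inj₁ (z<s , z<s))

    module _ {Q : X → Set} where

      QI : Items → Set
      QI = Any (λ y → Q (proj₁ y))

      any⁺ : ∀ {t I t′} → Contracts t I t′ → AnyT Q t → QI I ⊎ AnyT QI t′
      any⁺-l : ∀ {l I t x J} → Contracts l I t → AnyT Q l → QI (x ∷ I ++ J) ⊎ AnyT QI t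
      any⁺-r : ∀ {r J u x} I → Contracts r J u → AnyT Q r → QI (x ∷ I ++ J) ⊎ AnyT QI u
      any⁺-l c = Sum.map₁ (there ∘ Any.++⁺ˡ) ∘ any⁺ c
      any⁺-r I d = Sum.map₁ (there ∘ Any.++⁺ʳ I) ∘ any⁺ d
      any⁺ (closed c d _) (here q)  = inj₂ (here (here q))
      any⁺ (closed c d _) (left a)  = inj₂ (Sum.[ here , left ]′ (any⁺-l c a))
      any⁺ (closed {I = I} c d _) (right a) = inj₂ (Sum.[ here , right ]′ (any⁺-r I d a))
      any⁺ (openˡ c d _)  (here q)  = inj₁ (here q)
      any⁺ (openˡ c d _)  (left a)  = any⁺-l c a
      any⁺ (openˡ {I = I} c d _)  (right a) with any⁺-r I d a
      ... | inj₁ i = inj₁ i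
      any⁺ (openʳ c d _)  (here q)  = inj₁ (here q)
      any⁺ (openʳ c d _)  (left a)  with any⁺-l c a
      ... | inj₁ i = inj₁ i
      any⁺ (openʳ {I = I} c d _)  (right a) = any⁺-r I d a

      items⁻ : ∀ {t I t′} → Contracts t I t′ → QI I → AnyT Q t
      merged⁻ : ∀ {S x l r I J t u} → Contracts l I t → Contracts r J u →
                QI (item S x l r ∷ I ++ J) → AnyT Q (node S x l r)
      merged⁻ c d (here q) = here q
      merged⁻ {I = I} c d (there i) with Any.++⁻ I i
      ... | inj₁ i′ = left (items⁻ c i′)
      ... | inj₂ i′ = right (items⁻ d i′)
      items⁻ (openˡ c d _) i = merged⁻ c d i
      items⁻ (openʳ c d _) i = merged⁻ c d i

      rest⁻ : ∀ {t I t′} → Contracts t I t′ → AnyT QI t′ → AnyT Q t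
      rest⁻ (closed c d _) (here i)  = merged⁻ c d i
      rest⁻ (closed c d _) (left a)  = left (rest⁻ c a)
      rest⁻ (closed c d _) (right a) = right (rest⁻ d a)
      rest⁻ (openˡ c d _) a = left (rest⁻ c a)
      rest⁻ (openʳ c d _) a = right (rest⁻ d a)

    all⁺ : ∀ {Q : X → Set} {t I t′} → Contracts t I t′ → AllT (λ _ → Q) t →
           All (λ y → Q (proj₁ y)) I × AllT (λ _ → All (λ y → Q (proj₁ y))) t′
    all⁺ nil nil = [] , nil
    all⁺ (closed c d _) (node q ql qr) =
      let i , t = all⁺ c ql
          j , u = all⁺ d qr in [] , node (q ∷ All.++⁺ i j) t u
    all⁺ (openˡ c d _) (node q ql qr) =
      let i , t = all⁺ c ql
          j , u = all⁺ d qr in q ∷ All.++⁺ i j , t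
    all⁺ (openʳ c d _) (node q ql qr) =
      let i , t = all⁺ c ql
          j , u = all⁺ d qr in q ∷ All.++⁺ i j , u

    sumI-++ : ∀ f I J → sumI f (I ++ J) ≡ sumI f I + sumI f J
    sumI-++ f []      J = refl
    sumI-++ f (y ∷ I) J =
      trans (cong (f (proj₁ y) +_) (sumI-++ f I J)) (sym (+-assoc (f (proj₁ y)) (sumI f I) (sumI f J)))

    module _ (f : X → ℕ) where

      -- Contraction only regroups the nodes. Kept general in `f`, since it is applied both to the
      -- weight `w` and to the number of drawn cells.
      weigh-contracts : ∀ {t I t′} → Contracts t I t′ → sumI f I + weigh (sumI f) t′ ≡ weigh f t
      weigh-merged : ∀ {S x l r I J t u} → Contracts l I t → Contracts r J u →
                     sumI f (item S x l r ∷ I ++ J) + (weigh (sumI f) t + weigh (sumI f) u) ≡ weigh f (node S x l r)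
      weigh-merged {x = x} {l} {r} {I} {J} {t} {u} c d = begin
        f x + sumI f (I ++ J) + (wt + wu)           ≡⟨ cong (λ z → f x + z + (wt + wu)) (sumI-++ f I J) ⟩
        f x + (sumI f I + sumI f J) + (wt + wu)     ≡⟨ +-assoc (f x) (sumI f I + sumI f J) _ ⟩
        f x + (sumI f I + sumI f J + (wt + wu))     ≡⟨ cong (f x +_) (interchange +-commutativeSemigroup (sumI f I) (sumI f J) wt wu) ⟩
        f x + (sumI f I + wt + (sumI f J + wu))     ≡⟨ cong (f x +_) (cong₂ _+_ (weigh-contracts c) (weigh-contracts d)) ⟩
        f x + (weigh f l + weigh f r)               ∎
        where
        open ≡-Reasoning
        wt wu : ℕ
        wt = weigh (sumI f) t
        wu = weigh (sumI f) u
      weigh-contracts nil = refl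
      weigh-contracts (closed {S} {l = l} {r} c d _) = weigh-merged {S} {l = l} {r} c d
      weigh-contracts (openˡ {S} {x} {l} {r} {I} {J} {t} c d _) =
        trans (cong (sumI f (item S x l r ∷ I ++ J) +_) (sym (+-identityʳ (weigh (sumI f) t))))
          (weigh-merged {S} {l = l} {r} c d)
      weigh-contracts (openʳ {S} {l = l} {r} c d _) = weigh-merged {S} {l = l} {r} c d

    items-light : ∀ {t I t′} → Contracts t I t′ → wI I ≤ b
    items-light nil            = z≤n
    items-light (closed _ _ _) = z≤n
    items-light (openˡ _ _ ≤b) = ≤b
    items-light (openʳ _ _ ≤b) = ≤b

    rest-light : ∀ {t I t′ m} → Contracts t I t′ → AllT (λ _ x → w x ≤ m) t → AllT (λ _ J → wI J ≤ m + (b + b)) t′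
    rest-light nil nil = nil
    rest-light (closed {I = I} {J} c d _) (node x≤ l≤ r≤) = node
      (+-mono-≤ x≤ (≤-trans (≤-reflexive (sumI-++ w I J)) (+-mono-≤ (items-light c) (items-light d))))
      (rest-light c l≤) (rest-light d r≤)
    rest-light (openˡ c d _) (node _ l≤ _) = rest-light c l≤
    rest-light (openʳ c d _) (node _ _ r≤) = rest-light d r≤

    -- Clusters with clusters below on both sides are outnumbered by the leaf clusters, which are heavy.
    few : ∀ {t I t′} → Contracts t I t′ → count t′ ≡ 0 ⊎ count t′ * suc b + suc b ≤ 2 * weigh wI t′
    few nil = inj₁ refl
    few (openˡ c d _) = few c
    few (openʳ c d _) = few d
    few (closed {S} {x} {l} {r} {I} {J} {t} {u} c d why) = inj₂ (bound (few c) (few d) why)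
      where
      open ≤-Reasoning
      g = suc b
      i = wI (item S x l r ∷ I ++ J)
      M N wt wu : ℕ
      M  = count t
      N  = count u
      wt = weigh wI t
      wu = weigh wI u


      collect : ∀ i a b → 2 * i + (2 * a + 2 * b) ≡ 2 * (i + (a + b))
      collect = solve-∀

      spread : ∀ M N g → suc (M + N) * g + g ≡ (M * g + g) + (N * g + g)
      spread = solve-∀

      spread₂ : ∀ N g → suc N * g + g ≡ g + (N * g + g)
      spread₂ = solve-∀

      heavy : g ≤ i → g ≤ 2 * i
      heavy g≤i = ≤-trans g≤i (m≤m+n i _)

      -- Each side brings a spare `g`. One of them pays for the new cluster and the other remains
      -- spare, so a branching cluster needs no weight of its own.
      two : M * g + g ≤ 2 * wt → N * g + g ≤ 2 * wu → suc (M + N) * g + g ≤ 2 * (i + (wt + wu))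
      two p q = begin
        suc (M + N) * g + g          ≡⟨ spread M N g ⟩
        (M * g + g) + (N * g + g)    ≤⟨ +-mono-≤ p q ⟩
        2 * wt + 2 * wu              ≤⟨ m≤n+m _ (2 * i) ⟩
        2 * i + (2 * wt + 2 * wu)    ≡⟨ collect i wt wu ⟩
        2 * (i + (wt + wu))          ∎

      bound : M ≡ 0 ⊎ M * g + g ≤ 2 * wt → N ≡ 0 ⊎ N * g + g ≤ 2 * wu →
              (0 < M × 0 < N) ⊎ b < i → suc (M + N) * g + g ≤ 2 * (i + (wt + wu))
      bound (inj₂ p) (inj₂ q) _ = two p q
      bound (inj₁ M≡0) _ (inj₁ (0<M , _)) = ⊥-elim (<⇒≢ 0<M (sym M≡0))
      bound _ (inj₁ N≡0) (inj₁ (_ , 0<N)) = ⊥-elim (<⇒≢ 0<N (sym N≡0))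
      bound (inj₁ M≡0) (inj₁ N≡0) (inj₂ g≤i) = begin
        suc (M + N) * g + g          ≡⟨ cong₂ (λ m n → suc (m + n) * g + g) M≡0 N≡0 ⟩
        1 * g + g                    ≡⟨ cong (_+ g) (*-identityˡ g) ⟩
        g + g                        ≤⟨ +-mono-≤ g≤i g≤i ⟩
        i + i                        ≡⟨ cong (i +_) (+-identityʳ i) ⟨
        2 * i                        ≤⟨ *-monoʳ-≤ 2 (m≤m+n i (wt + wu)) ⟩
        2 * (i + (wt + wu))          ∎
      bound (inj₁ M≡0) (inj₂ q) (inj₂ g≤i) = begin
        suc (M + N) * g + g          ≡⟨ cong (λ m → suc (m + N) * g + g) M≡0 ⟩
        suc N * g + g                ≡⟨ spread₂ N g ⟩
        g + (N * g + g)              ≤⟨ +-mono-≤ (heavy g≤i) (≤-trans q (m≤n+m _ (2 * wt))) ⟩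
        2 * i + (2 * wt + 2 * wu)    ≡⟨ collect i wt wu ⟩
        2 * (i + (wt + wu))          ∎
      bound (inj₂ p) (inj₁ N≡0) (inj₂ g≤i) = begin
        suc (M + N) * g + g          ≡⟨ cong (λ n → suc n * g + g) (trans (cong (M +_) N≡0) (+-identityʳ M)) ⟩
        suc M * g + g                ≡⟨ spread₂ M g ⟩
        g + (M * g + g)              ≤⟨ +-mono-≤ (heavy g≤i) (≤-trans p (m≤m+n _ (2 * wu))) ⟩
        2 * i + (2 * wt + 2 * wu)    ≡⟨ collect i wt wu ⟩
        2 * (i + (wt + wu))          ∎

    -- If the open cluster is empty, the subtree was closed at its root or is `nil`, and its
    -- adhesion survives. Otherwise the root item is still open and its ports include the old top.
    -- In both cases the tops below a new cluster are ports of that cluster, as `left⊆` and `right⊆`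
    -- require.
    tops : ∀ {t I t′} → Contracts t I t′ → (I ≡ [] × top t′ ≡ top t) ⊎ (top t ⊆ ports I × top t′ ⊆ ports I)
    top-l : ∀ {S x l r I J t} → Contracts l I t → top t ⊆ ports (item S x l r ∷ I ++ J)
    top-r : ∀ {S x l r J u} I → Contracts r J u → top u ⊆ ports (item S x l r ∷ I ++ J)
    ports-++ : ∀ I J → ports (I ++ J) ≡ ports I ++ ports J
    ports-++ I J = List.concatMap-++ proj₂ I J
    top-l {S} {x} {l} {r} {I} {J} c {v} v∈ with tops c
    ... | inj₁ (refl , eq) = ∈-++⁺ˡ (∈-++⁺ʳ S (∈-++⁺ˡ (subst (v ∈_) eq v∈)))
    ... | inj₂ (_ , ⊆I) = ∈-++⁺ʳ (S ++ top l ++ top r) (subst (v ∈_) (sym (ports-++ I J)) (∈-++⁺ˡ (⊆I v∈)))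
    top-r {S} {x} {l} {r} {J} I c {v} v∈ with tops c
    ... | inj₁ (refl , eq) = ∈-++⁺ˡ (∈-++⁺ʳ S (∈-++⁺ʳ (top l) (subst (v ∈_) eq v∈)))
    ... | inj₂ (_ , ⊆J) = ∈-++⁺ʳ (S ++ top l ++ top r) (subst (v ∈_) (sym (ports-++ I J)) (∈-++⁺ʳ (ports I) (⊆J v∈)))
    tops nil = inj₁ (refl , refl)
    tops (closed _ _ _) = inj₁ (refl , refl)
    tops (openˡ {S} {x} {l} {r} c d _) = inj₂ (∈-++⁺ˡ ∘ ∈-++⁺ˡ , top-l {S} {x} {l} {r} c)
    tops (openʳ {S} {x} {l} {r} {I} c d _) = inj₂ (∈-++⁺ˡ ∘ ∈-++⁺ˡ , top-r {S} {x} {l} {r} I d)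

    SeparatedI : (V → Set) → Tree Items → Set
    SeparatedI = Separated OccI ports

    Bordered : (V → Set) → Items → Set
    Bordered O = All (λ y → ∀ {v} → Occ v (proj₁ y) → O v → v ∈ proj₂ y)

    bordered-mono : ∀ {O O′ : V → Set} {I} → (∀ {v} → O′ v → O v) → Bordered O I → Bordered O′ I
    bordered-mono g []       = []
    bordered-mono g (f ∷ fs) = (λ vz o → f vz (g o)) ∷ bordered-mono g fs

    -- `bordered` is the strengthening that carries the induction: an item of the open cluster must
    -- already have as ports the vertices that it shares with items merged later, which are so far
    -- hidden in `O`.
    record Invariant (O : V → Set) (I : Items) (t : Tree Items) : Set where
      field
        good      : Good I
        goods     : AllT (λ _ → Good) t
        bordered  : Bordered (λ v → O v ⊎ AnyT (OccI v) t) I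
        separated : SeparatedI (λ v → O v ⊎ OccI v I) t

    module _ {O : V → Set} {S x l r I J t u} (c : Contracts l I t) (d : Contracts r J u)
             (sep : Separated Occ tr O (node S x l r))
             (invˡ : Invariant (λ v → O v ⊎ Occ v x ⊎ AnyT (Occ v) r) I t)
             (invʳ : Invariant (λ v → O v ⊎ Occ v x ⊎ AnyT (Occ v) l) J u) where
      private
        module L = Invariant invˡ
        module R = Invariant invʳ
        open Joint (proj₁ sep)
        P = S ++ top l ++ top r
        y = item S x l r

      -- Items of `I` and `J` lie on different sides of `x`, so each is outside for the other and
      -- `bordered` makes a common vertex a port of both. A vertex shared with `x` itself crosses
      -- the adhesion of `l` or `r`, which is among the ports of `y`.
      merged-good : Good (y ∷ I ++ J)
      merged-good =
        ((λ v∈ → Sum.[ top⊆ , (λ v∈ → Sum.[ left⊆ , right⊆ ]′ (∈-++⁻ (top l) v∈)) ]′ (∈-++⁻ S v∈)) ,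
         length-P) ∷ All.++⁺ (proj₁ L.good) (proj₁ R.good) ,
        All.++⁺ (All.tabulate x~I) (All.tabulate x~J) ∷
        AllPairs.++⁺ (proj₂ L.good) (proj₂ R.good) (All.tabulate λ z∈ → All.tabulate (I~J z∈))
        where
        length-P : length P ≤ 3 * K
        length-P = begin
          length P ≡⟨ trans (List.length-++ S) (cong (length S +_) (List.length-++ (top l))) ⟩
          length S + (length (top l) + length (top r))
            ≤⟨ +-mono-≤ small (+-mono-≤ (top-small Occ tr l (proj₁ (proj₂ sep))) (top-small Occ tr r (proj₂ (proj₂ sep)))) ⟩
          K + (K + K) ≡⟨ cong (λ z → K + (K + z)) (+-identityʳ K) ⟨
          3 * K ∎
          where open ≤-Reasoning

        x~I : ∀ {z} → z ∈ I → Coherent y z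
        x~I z∈ v vx vz =
          ∈-++⁺ʳ S (∈-++⁺ˡ (separated-top Occ tr l (proj₁ (proj₂ sep)) (inj₂ (inj₁ vx)) (items⁻ c (lose z∈ vz)))) ,
          All.lookup L.bordered z∈ vz (inj₁ (inj₂ (inj₁ vx)))

        x~J : ∀ {z} → z ∈ J → Coherent y z
        x~J z∈ v vx vz =
          ∈-++⁺ʳ S (∈-++⁺ʳ (top l) (separated-top Occ tr r (proj₂ (proj₂ sep)) (inj₂ (inj₁ vx)) (items⁻ d (lose z∈ vz)))) ,
          All.lookup R.bordered z∈ vz (inj₁ (inj₂ (inj₁ vx)))

        I~J : ∀ {z z′} → z ∈ I → z′ ∈ J → Coherent z z′
        I~J z∈ z′∈ v vz vz′ =
          All.lookup L.bordered z∈ vz (inj₁ (inj₂ (inj₂ (items⁻ d (lose z′∈ vz′))))) ,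
          All.lookup R.bordered z′∈ vz′ (inj₁ (inj₂ (inj₂ (items⁻ c (lose z∈ vz)))))

      merged-bordered : Bordered (λ v → O v ⊎ AnyT (OccI v) t ⊎ AnyT (OccI v) u) (y ∷ I ++ J)
      merged-bordered = x-bordered ∷ All.++⁺ (All.map toˡ L.bordered) (All.map toʳ R.bordered)
        where
        x-bordered : ∀ {v} → Occ v x → O v ⊎ AnyT (OccI v) t ⊎ AnyT (OccI v) u → v ∈ P
        x-bordered vx (inj₁ o) = ∈-++⁺ˡ (separates o (here vx))
        x-bordered vx (inj₂ (inj₁ a)) =
          ∈-++⁺ʳ S (∈-++⁺ˡ (separated-top Occ tr l (proj₁ (proj₂ sep)) (inj₂ (inj₁ vx)) (rest⁻ c a)))
        x-bordered vx (inj₂ (inj₂ a)) =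
          ∈-++⁺ʳ S (∈-++⁺ʳ (top l) (separated-top Occ tr r (proj₂ (proj₂ sep)) (inj₂ (inj₁ vx)) (rest⁻ d a)))

        toˡ : ∀ {z : X × List V} →
              (∀ {v} → Occ v (proj₁ z) → (O v ⊎ Occ v x ⊎ AnyT (Occ v) r) ⊎ AnyT (OccI v) t → v ∈ proj₂ z) →
              ∀ {v} → Occ v (proj₁ z) → O v ⊎ AnyT (OccI v) t ⊎ AnyT (OccI v) u → v ∈ proj₂ z
        toˡ f vz (inj₁ o)        = f vz (inj₁ (inj₁ o))
        toˡ f vz (inj₂ (inj₁ a)) = f vz (inj₂ a)
        toˡ f vz (inj₂ (inj₂ a)) = f vz (inj₁ (inj₂ (inj₂ (rest⁻ d a))))

        toʳ : ∀ {z : X × List V} →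
              (∀ {v} → Occ v (proj₁ z) → (O v ⊎ Occ v x ⊎ AnyT (Occ v) l) ⊎ AnyT (OccI v) u → v ∈ proj₂ z) →
              ∀ {v} → Occ v (proj₁ z) → O v ⊎ AnyT (OccI v) t ⊎ AnyT (OccI v) u → v ∈ proj₂ z
        toʳ f vz (inj₁ o)        = f vz (inj₁ (inj₁ o))
        toʳ f vz (inj₂ (inj₁ a)) = f vz (inj₁ (inj₂ (inj₂ (rest⁻ c a))))
        toʳ f vz (inj₂ (inj₂ a)) = f vz (inj₂ a)

      merged-separatedˡ : SeparatedI (λ v → O v ⊎ OccI v (y ∷ I ++ J) ⊎ AnyT (OccI v) u) t
      merged-separatedˡ = separated-mono OccI ports t (λ o _ → outside o) L.separated
        where
        outside : ∀ {v} → O v ⊎ OccI v (y ∷ I ++ J) ⊎ AnyT (OccI v) u →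
                  (O v ⊎ Occ v x ⊎ AnyT (Occ v) r) ⊎ OccI v I
        outside (inj₁ o) = inj₁ (inj₁ o)
        outside (inj₂ (inj₁ (here vx))) = inj₁ (inj₂ (inj₁ vx))
        outside (inj₂ (inj₁ (there i))) with Any.++⁻ I i
        ... | inj₁ i′ = inj₂ i′
        ... | inj₂ i′ = inj₁ (inj₂ (inj₂ (items⁻ d i′)))
        outside (inj₂ (inj₂ a)) = inj₁ (inj₂ (inj₂ (rest⁻ d a)))

      merged-separatedʳ : SeparatedI (λ v → O v ⊎ OccI v (y ∷ I ++ J) ⊎ AnyT (OccI v) t) u
      merged-separatedʳ = separated-mono OccI ports u (λ o _ → outside o) R.separated
        where
        outside : ∀ {v} → O v ⊎ OccI v (y ∷ I ++ J) ⊎ AnyT (OccI v) t →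
                  (O v ⊎ Occ v x ⊎ AnyT (Occ v) l) ⊎ OccI v J
        outside (inj₁ o) = inj₁ (inj₁ o)
        outside (inj₂ (inj₁ (here vx))) = inj₁ (inj₂ (inj₁ vx))
        outside (inj₂ (inj₁ (there i))) with Any.++⁻ I i
        ... | inj₁ i′ = inj₁ (inj₂ (inj₂ (items⁻ c i′)))
        ... | inj₂ i′ = inj₂ i′
        outside (inj₂ (inj₂ a)) = inj₁ (inj₂ (inj₂ (rest⁻ c a)))

      merged-joint : ∀ {O′ : V → Set} → (∀ {v} → O′ v → O v) → Joint OccI ports O′ S (y ∷ I ++ J) t u
      merged-joint f = record
        { small     = small
        ; separates = λ o a → separates (f o) (back a)
        ; top⊆      = ∈-++⁺ˡ ∘ ∈-++⁺ˡ
        ; left⊆     = top-l {S} {x} {l} {r} c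
        ; right⊆    = top-r {S} {x} {l} {r} I d
        }
        where
        back : ∀ {v} → AnyT (OccI v) (node S (y ∷ I ++ J) t u) → AnyT (Occ v) (node S x l r)
        back (here i)  = merged⁻ c d i
        back (left a)  = left (rest⁻ c a)
        back (right a) = right (rest⁻ d a)

    invariant : ∀ {O t I t′} → Contracts t I t′ → Separated Occ tr O t → Invariant O I t′
    invariant nil sep = record { good = [] , [] ; goods = nil ; bordered = [] ; separated = tt }
    invariant (closed {t = t} {u} c d _) sep@(_ , sl , sr) =
      let invˡ = invariant c sl
          invʳ = invariant d sr in record
      { good      = [] , []
      ; goods     = node (merged-good c d sep invˡ invʳ) (Invariant.goods invˡ) (Invariant.goods invʳ)
      ; bordered  = []
      ; separated = merged-joint c d sep invˡ invʳ (λ { (inj₁ o) → o }) ,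
                    separated-mono OccI ports t (λ { (inj₁ (inj₁ o)) _ → inj₁ o ; (inj₂ o) _ → inj₂ o })
                      (merged-separatedˡ c d sep invˡ invʳ) ,
                    separated-mono OccI ports u (λ { (inj₁ (inj₁ o)) _ → inj₁ o ; (inj₂ o) _ → inj₂ o })
                      (merged-separatedʳ c d sep invˡ invʳ)
      }
    invariant (openˡ {t = t} c d _) sep@(_ , sl , sr) =
      let invˡ = invariant c sl
          invʳ = invariant d sr in record
      { good      = merged-good c d sep invˡ invʳ
      ; goods     = Invariant.goods invˡ
      ; bordered  = bordered-mono (Sum.map₂ inj₁) (merged-bordered c d sep invˡ invʳ)
      ; separated = separated-mono OccI ports t (λ o _ → Sum.map₂ inj₁ o) (merged-separatedˡ c d sep invˡ invʳ)
      }
    invariant (openʳ {u = u} c d _) sep@(_ , sl , sr) =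
      let invˡ = invariant c sl
          invʳ = invariant d sr in record
      { good      = merged-good c d sep invˡ invʳ
      ; goods     = Invariant.goods invʳ
      ; bordered  = bordered-mono (Sum.map₂ inj₂) (merged-bordered c d sep invˡ invʳ)
      ; separated = separated-mono OccI ports u (λ o _ → Sum.map₂ inj₁ o) (merged-separatedʳ c d sep invˡ invʳ)
      }

    finish : List V → Items → Tree Items → Tree Items
    finish S []        t = t
    finish S I@(_ ∷ _) t = node S I t nil

    module _ {t I t′} (c : Contracts t I t′) where

      finish⁺ : ∀ {Q : X → Set} → AnyT Q t → AnyT (QI {Q}) (finish (top t) I t′)
      finish⁺ {Q} a = go I (any⁺ c a)
        where
        go : ∀ {S} I → QI {Q} I ⊎ AnyT (QI {Q}) t′ → AnyT (QI {Q}) (finish S I t′)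
        go []      (inj₂ a) = a
        go (_ ∷ _) (inj₁ i) = here i
        go (_ ∷ _) (inj₂ a) = left a

      weigh-finish : ∀ f → weigh (sumI f) (finish (top t) I t′) ≡ weigh f t
      weigh-finish f = trans (go I) (weigh-contracts f c)
        where
        go : ∀ {S} I → weigh (sumI f) (finish S I t′) ≡ sumI f I + weigh (sumI f) t′
        go []      = refl
        go (y ∷ I) = cong (sumI f (y ∷ I) +_) (+-identityʳ (weigh (sumI f) t′))

      finish-all : ∀ {P : List V → Items → Set} → P (top t) I → AllT P t′ → AllT P (finish (top t) I t′)
      finish-all = go I
        where
        go : ∀ {S} I {P : List V → Items → Set} → P S I → AllT P t′ → AllT P (finish S I t′)
        go []      _ ps = ps
        go (_ ∷ _) p ps = node p ps nil

      finish-separated : Separated Occ tr (λ _ → ⊥) t → SeparatedI (λ _ → ⊥) (finish (top t) I t′)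
      finish-separated sep = go I (tops c) (Invariant.separated (invariant c sep))
        where
        go : ∀ I → (I ≡ [] × top t′ ≡ top t) ⊎ (top t ⊆ ports I × top t′ ⊆ ports I) →
             SeparatedI (λ v → ⊥ ⊎ OccI v I) t′ → SeparatedI (λ _ → ⊥) (finish (top t) I t′)
        go []      _ s = separated-mono OccI ports t′ (λ ()) s
        go (_ ∷ _) (inj₂ (⊆I , ⊆I′)) s =
          record { small = top-small Occ tr t sep ; separates = λ () ; top⊆ = ⊆I ; left⊆ = ⊆I′ ; right⊆ = λ () } ,
          separated-mono OccI ports t′ (λ { (inj₂ (inj₁ i)) _ → inj₂ i ; (inj₂ (inj₂ ())) }) s ,
          tt

      -- The root cluster is closed whatever its weight. The spare `suc b` in the bound of `few`
      -- pays for it; if there is no other cluster, it stands alone.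
      finish-few : count (finish (top t) I t′) ≤ 1 ⊎ count (finish (top t) I t′) * suc b ≤ 2 * weigh w t
      finish-few = go I (few c) (≤-trans (m≤n+m _ (wI I)) (≤-reflexive (weigh-contracts w c)))
        where
        go : ∀ I → count t′ ≡ 0 ⊎ count t′ * suc b + suc b ≤ 2 * weigh wI t′ → weigh wI t′ ≤ weigh w t →
             count (finish (top t) I t′) ≤ 1 ⊎ count (finish (top t) I t′) * suc b ≤ 2 * weigh w t
        go []      (inj₁ eq) _ = inj₁ (≤-trans (≤-reflexive eq) z≤n)
        go (_ ∷ _) (inj₁ eq) _ = inj₁ (s≤s (≤-reflexive (trans (+-identityʳ _) eq)))
        go []      (inj₂ p)  q = inj₂ (≤-trans (m≤m+n _ (suc b)) (≤-trans p (*-monoʳ-≤ 2 q)))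
        go (_ ∷ _) (inj₂ p)  q = inj₂ (begin
          suc (count t′ + 0) * suc b  ≡⟨ cong (λ z → suc z * suc b) (+-identityʳ (count t′)) ⟩
          suc b + count t′ * suc b    ≡⟨ +-comm (suc b) _ ⟩
          count t′ * suc b + suc b    ≤⟨ p ⟩
          2 * weigh wI t′             ≤⟨ *-monoʳ-≤ 2 q ⟩
          2 * weigh w t               ∎)
          where open ≤-Reasoning

    -- If S together with own x always covers x, then the items of a cluster need only
    -- own their vertices: the rest comes from the top.
    module _ (own : X → List V) (tr⇒occ : ∀ {x v} → v ∈ tr x → Occ v x) where

      Owned : List V → X → Set
      Owned S x = ∀ {v} → Occ v x → v ∈ own x ++ S

      owns : Items → List V
      owns = concatMap (λ y → own (proj₁ y))

      owns-++ : ∀ I J → owns (I ++ J) ≡ owns I ++ owns J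
      owns-++ = List.concatMap-++ (λ y → own (proj₁ y))

      OwnedI : List V → Items → Set
      OwnedI S I = ∀ {v} → OccI v I → v ∈ owns I ++ S

      owned-items : ∀ {O t I t′} → Contracts t I t′ → Separated Occ tr O t → AllT Owned t → OwnedI (top t) I
      owned-merged : ∀ {O S x l r I J t u} → Contracts l I t → Contracts r J u →
                     Separated Occ tr O (node S x l r) → AllT Owned (node S x l r) → OwnedI S (item S x l r ∷ I ++ J)
      owned-merged {S = S} {x} {l} {r} {I} {J} c d (j , sl , sr) (node ox ol or) {v} = λ where
          (here vx)  → widen-x (ox vx)
          (there vi) → Sum.[ from-l , from-r ]′ (Any.++⁻ I vi)
        where
        widen-x : v ∈ own x ++ S → v ∈ (own x ++ owns (I ++ J)) ++ S
        widen-x v∈ with ∈-++⁻ (own x) v∈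
        ... | inj₁ v∈x = ∈-++⁺ˡ (∈-++⁺ˡ v∈x)
        ... | inj₂ v∈S = ∈-++⁺ʳ (own x ++ owns (I ++ J)) v∈S

        widen : v ∈ owns I ++ owns J → v ∈ (own x ++ owns (I ++ J)) ++ S
        widen v∈ = ∈-++⁺ˡ (∈-++⁺ʳ (own x) (subst (v ∈_) (sym (owns-++ I J)) v∈))

        from-l : OccI v I → v ∈ (own x ++ owns (I ++ J)) ++ S
        from-l vi with ∈-++⁻ (owns I) (owned-items c sl ol vi)
        ... | inj₁ v∈I = widen (∈-++⁺ˡ v∈I)
        -- A vertex inherited from the top of `l` occurs in `x`, by `left⊆`, so `x` owns it or
        -- passes the debt on to `S`.
        ... | inj₂ v∈l = widen-x (ox (tr⇒occ (Joint.left⊆ j v∈l)))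

        from-r : OccI v J → v ∈ (own x ++ owns (I ++ J)) ++ S
        from-r vi with ∈-++⁻ (owns J) (owned-items d sr or vi)
        ... | inj₁ v∈J = widen (∈-++⁺ʳ (owns I) v∈J)
        ... | inj₂ v∈r = widen-x (ox (tr⇒occ (Joint.right⊆ j v∈r)))
      owned-items (openˡ c d _) sep o = owned-merged c d sep o
      owned-items (openʳ c d _) sep o = owned-merged c d sep o

      owned-rest : ∀ {O t I t′} → Contracts t I t′ → Separated Occ tr O t → AllT Owned t → AllT OwnedI t′
      owned-rest nil _ _ = nil
      owned-rest (closed c d _) sep@(_ , sl , sr) o@(node _ ol or) =
        node (owned-merged c d sep o) (owned-rest c sl ol) (owned-rest d sr or)
      owned-rest (openˡ c d _) (_ , sl , _) (node _ ol _) = owned-rest c sl ol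
      owned-rest (openʳ c d _) (_ , _ , sr) (node _ _ or) = owned-rest d sr or

-- From a tree decomposition to a rooted binary tree

module _ {m : ℕ} (T : Graph m) where

  open DecMembership (Fin._≟_ {m}) using (_∈?_)

  Walk : (Fin m → Set) → Fin m → Fin m → Set
  Walk P = Star (λ s r → P s × P r × Adj T s r)

  walk-map : ∀ {P Q : Fin m → Set} → (∀ {x} → P x → Q x) → ∀ {x y} → Walk P x y → Walk Q x y
  walk-map f = Star.map λ (ps , pr , e) → f ps , f pr , e

  walk-sym : ∀ {P x y} → Walk P x y → Walk P y x
  walk-sym = Star.reverse λ (ps , pr , e) → pr , ps , Graph.symmetric T e

  AvoidingPath : Fin m → List (Fin m) → Set
  AvoidingPath t xs = Unique xs × Linked (Adj T) xs × All (t ≢_) xs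

  path-tail : ∀ {t x xs} → AvoidingPath t (x ∷ xs) → AvoidingPath t xs
  path-tail (_ ∷ u , l , _ ∷ a) = u , Linked.tail l , a

  suffix : ∀ {t p q} xs → AvoidingPath t (xs ∷ʳ q) → p ∈ xs ∷ʳ q → p ≡ q ⊎ ∃ λ vs → AvoidingPath t (p ∷ vs ∷ʳ q)
  suffix []       path (here p≡q) = inj₁ p≡q
  suffix (x ∷ xs) path (here refl) = inj₂ (xs , path)
  suffix (x ∷ xs) path (there p∈) = suffix xs (path-tail path) p∈

  erase-loops : ∀ {t p q} → Walk (t ≢_) p q → p ≡ q ⊎ ∃ λ vs → AvoidingPath t (p ∷ vs ∷ʳ q)
  erase-loops ε = inj₁ refl
  erase-loops {t} {p} {q} ((t≢p , t≢x , e) ◅ walk) with erase-loops walk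
  ... | inj₁ refl with p Fin.≟ q
  ...   | yes p≡q = inj₁ p≡q
  ...   | no  p≢q = inj₂ ([] , (p≢q ∷ []) ∷ [] ∷ [] , e ∷ [-] , t≢p ∷ t≢x ∷ [])
  erase-loops {t} {p} {q} ((t≢p , t≢x , e) ◅ walk) | inj₂ (vs , path@(u , l , a)) with p ∈? _ ∷ vs ∷ʳ q
  ...   | yes p∈ = suffix (_ ∷ vs) path p∈
  ...   | no  p∉ = inj₂ (_ ∷ vs , All.¬Any⇒All¬ _ p∉ ∷ u , e ∷ l , t≢p ∷ a)

  -- With its loops erased, a walk from `p` to `q` that avoids `t` would close up through `t` to a
  -- cycle, unless `p` and `q` coincide.
  neighbours-separated : Acyclic T → ∀ {t p q} → Adj T t p → Adj T t q → Walk (t ≢_) p q → p ≡ q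
  neighbours-separated acyclic {t} {p} {q} tp tq walk with erase-loops walk
  ... | inj₁ p≡q = p≡q
  ... | inj₂ (vs , u , l , a) = ⊥-elim (acyclic t p vs q (a ∷ u) (tp ∷ l) (Graph.symmetric T tq))

  crossing-edge : ∀ {vis x t} → x ∈ vis → t ∉ vis → Walk (λ _ → ⊤) x t →
                  ∃₂ λ p q → p ∈ vis × q ∉ vis × Adj T p q
  crossing-edge x∈ t∉ ε = ⊥-elim (t∉ x∈)
  crossing-edge {vis} x∈ t∉ (_◅_ {j = y} (_ , _ , e) walk) with y ∈? vis
  ... | yes y∈ = crossing-edge y∈ t∉ walk
  ... | no  y∉ = _ , y , x∈ , y∉ , e

elements : ∀ {n} → Subset n → List (Fin n)
elements []          = []
elements (true  ∷ s) = zero ∷ map suc (elements s)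
elements (false ∷ s) = map suc (elements s)

length-elements : ∀ {n} (s : Subset n) → length (elements s) ≡ ∣ s ∣
length-elements []          = refl
length-elements (true  ∷ s) = cong suc (trans (List.length-map suc (elements s)) (length-elements s))
length-elements (false ∷ s) = trans (List.length-map suc (elements s)) (length-elements s)

∈-elements⁺ : ∀ {n} {s : Subset n} {v} → v ∈ₛ s → v ∈ elements s
∈-elements⁺ {s = true ∷ s}  {zero}  _           = here refl
∈-elements⁺ {s = true ∷ s}  {suc v} (Vec.there v∈) = there (∈-map⁺ suc (∈-elements⁺ v∈))
∈-elements⁺ {s = false ∷ s} {suc v} (Vec.there v∈) = ∈-map⁺ suc (∈-elements⁺ v∈)

∈-elements⁻ : ∀ {n} (s : Subset n) {v} → v ∈ elements s → v ∈ₛ s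
∈-elements⁻ (true ∷ s) (here refl) = Vec.here
∈-elements⁻ (true ∷ s) (there v∈) with ∈-map⁻ suc v∈
... | _ , v∈′ , refl = Vec.there (∈-elements⁻ s v∈′)
∈-elements⁻ (false ∷ s) v∈ with ∈-map⁻ suc v∈
... | _ , v∈′ , refl = Vec.there (∈-elements⁻ s v∈′)

elements-unique : ∀ {n} (s : Subset n) → Unique (elements s)
elements-unique []          = []
elements-unique (true  ∷ s) =
  All.map⁺ (All.tabulate λ _ ()) ∷ Unique.map⁺ Fin.suc-injective (elements-unique s)
elements-unique (false ∷ s) = Unique.map⁺ Fin.suc-injective (elements-unique s)

lookup-injective : ∀ {A : Set} {xs : List A} → Unique xs → ∀ {i j} → lookup xs i ≡ lookup xs j → i ≡ j
lookup-injective (_ ∷ _)  {zero}  {zero}  _  = refl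
lookup-injective (x∉ ∷ _) {zero}  {suc j} eq = ⊥-elim (All.lookup x∉ (∈-lookup j) eq)
lookup-injective (x∉ ∷ _) {suc i} {zero}  eq = ⊥-elim (All.lookup x∉ (∈-lookup i) (sym eq))
lookup-injective (_ ∷ u)  {suc i} {suc j} eq = cong suc (lookup-injective u eq)

unique-length : ∀ {n} {xs : List (Fin n)} → Unique xs → length xs ≤ n
unique-length u = Fin.injective⇒≤ (lookup-injective u)

module _ {n : ℕ} (G : Graph n) (D : TreeDecomposition G) (K : ℕ)
         (bags≤ : ∀ t → ∣ TreeDecomposition.bag D t ∣ ≤ K) where

  open TreeDecomposition D hiding (width)
  open Trees (Fin n) K
  open DecMembership (Fin._≟_ {n}) using (_∈?_)
  module Nodes = DecMembership (Fin._≟_ {nodes})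

  bagList : Fin nodes → List (Fin n)
  bagList t = elements (bag t)

  length-bagList : ∀ t → length (bagList t) ≤ K
  length-bagList t = ≤-trans (≤-reflexive (length-elements (bag t))) (bags≤ t)

  -- A tree node together with the vertices that it introduces.
  Label : Set
  Label = Fin nodes × List (Fin n)

  vertices : Label → List (Fin n)
  vertices x = bagList (proj₁ x)

  Occurs : Fin n → Label → Set
  Occurs v x = v ∈ vertices x

  Holds : Fin nodes → Label → Set
  Holds t x = proj₁ x ≡ t

  load : Label → ℕ
  load x = length (proj₂ x)

  SeparatedB : (Fin n → Set) → Tree Label → Set
  SeparatedB = Separated Occurs vertices

  Introduces : List (Fin n) → Label → Set
  Introduces S x = ∀ {v} → v ∈ vertices x → v ∈ proj₂ x ++ S

  old new : Fin nodes → Fin nodes → List (Fin n)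
  old p t = filter (_∈? bagList p) (bagList t)
  new p t = filter (λ v → ¬? (v ∈? bagList p)) (bagList t)

  old⊎new : ∀ p t {v} → v ∈ bagList t → v ∈ new p t ++ old p t
  old⊎new p t {v} v∈ with v ∈? bagList p
  ... | yes v∈p = ∈-++⁺ʳ (new p t) (∈-filter⁺ (_∈? bagList p) v∈ v∈p)
  ... | no  v∉p = ∈-++⁺ˡ (∈-filter⁺ (λ v → ¬? (v ∈? bagList p)) v∈ v∉p)

  -- A new leaf t below a node holding p; a copy of p is spliced in to keep the tree binary.
  data Grafted (p t : Fin nodes) : Tree Label → Tree Label → Set where
    here  : ∀ {S A l r} → Grafted p t (node S (p , A) l r)
              (node S (p , A) l (node (bagList p) (p , []) (node (old p t) (t , new p t) nil nil) r))
    left  : ∀ {S x l r l′} → Grafted p t l l′ → Grafted p t (node S x l r) (node S x l′ r)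
    right : ∀ {S x l r r′} → Grafted p t r r′ → Grafted p t (node S x l r) (node S x l r′)

  graft : ∀ {p} t {T} → AnyT (Holds p) T → ∃ (Grafted p t T)
  graft t (here refl) = _ , here
  graft t (left a)    = let _ , g = graft t a in _ , left g
  graft t (right a)   = let _ , g = graft t a in _ , right g

  module _ {p t : Fin nodes} where

    grafted-top : ∀ {T T′} → Grafted p t T T′ → top T′ ≡ top T
    grafted-top here      = refl
    grafted-top (left _)  = refl
    grafted-top (right _) = refl

    grafted-keeps : ∀ {Q : Label → Set} {T T′} → Grafted p t T T′ → AnyT Q T → AnyT Q T′
    grafted-keeps here      (here eq) = here eq
    grafted-keeps here      (left a)  = left a
    grafted-keeps here      (right a) = right (right a)
    grafted-keeps (left g)  (here eq) = here eq
    grafted-keeps (left g)  (left a)  = left (grafted-keeps g a)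
    grafted-keeps (left g)  (right a) = right a
    grafted-keeps (right g) (here eq) = here eq
    grafted-keeps (right g) (left a)  = left a
    grafted-keeps (right g) (right a) = right (grafted-keeps g a)

    grafted-new : ∀ {T T′} → Grafted p t T T′ → AnyT (Holds t) T′
    grafted-new here      = right (left (here refl))
    grafted-new (left g)  = left (grafted-new g)
    grafted-new (right g) = right (grafted-new g)

    grafted-parent : ∀ {T T′ v} → Grafted p t T T′ → v ∈ bagList p → AnyT (Occurs v) T
    grafted-parent here      v∈ = here v∈
    grafted-parent (left g)  v∈ = left (grafted-parent g v∈)
    grafted-parent (right g) v∈ = right (grafted-parent g v∈)

    grafted-occurs : ∀ {T T′ v} → Grafted p t T T′ → AnyT (Occurs v) T′ → AnyT (Occurs v) T ⊎ v ∈ bagList t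
    grafted-occurs here      (here o)                 = inj₁ (here o)
    grafted-occurs here      (left a)                 = inj₁ (left a)
    grafted-occurs here      (right (here o))         = inj₁ (here o)
    grafted-occurs here      (right (left (here o)))  = inj₂ o
    grafted-occurs here      (right (left (left ())))
    grafted-occurs here      (right (left (right ())))
    grafted-occurs here      (right (right a))        = inj₁ (right a)
    grafted-occurs (left g)  (here o)                 = inj₁ (here o)
    grafted-occurs (left g)  (left a)                 = Sum.map₁ left (grafted-occurs g a)
    grafted-occurs (left g)  (right a)                = inj₁ (right a)
    grafted-occurs (right g) (here o)                 = inj₁ (here o)
    grafted-occurs (right g) (left a)                 = inj₁ (left a)
    grafted-occurs (right g) (right a)                = Sum.map₁ right (grafted-occurs g a)

    grafted-load : ∀ {T T′} → Grafted p t T T′ → weigh load T′ ≡ length (new p t) + weigh load T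
    grafted-load {node S x l r} here = begin
      load x + (weigh load l + (c + 0 + weigh load r)) ≡⟨ cong (λ z → load x + (weigh load l + (z + weigh load r))) (+-identityʳ c) ⟩
      load x + (weigh load l + (c + weigh load r))     ≡⟨ shuffle (load x) (weigh load l) c (weigh load r) ⟩
      c + (load x + (weigh load l + weigh load r))     ∎
      where
      open ≡-Reasoning
      c = length (new p t)
      shuffle : ∀ x l c r → x + (l + (c + r)) ≡ c + (x + (l + r))
      shuffle = solve-∀
    grafted-load {node S x l r} (left g) rewrite grafted-load g = shuffle (load x) (length (new p t)) (weigh load l) (weigh load r)
      where
      shuffle : ∀ x c l r → x + (c + l + r) ≡ c + (x + (l + r))
      shuffle = solve-∀
    grafted-load {node S x l r} (right g) rewrite grafted-load g = shuffle (load x) (weigh load l) (length (new p t)) (weigh load r)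
      where
      shuffle : ∀ x l c r → x + (l + (c + r)) ≡ c + (x + (l + r))
      shuffle = solve-∀

    grafted-all : ∀ {T T′} {Q : List (Fin n) → Label → Set} → Grafted p t T T′ →
                  Q (bagList p) (p , []) → Q (old p t) (t , new p t) → AllT Q T → AllT Q T′
    grafted-all here      qp qt (node q ql qr) = node q ql (node qp (node qt nil nil) qr)
    grafted-all (left g)  qp qt (node q ql qr) = node q (grafted-all g qp qt ql) qr
    grafted-all (right g) qp qt (node q ql qr) = node q ql (grafted-all g qp qt qr)

    -- The second hypothesis is all that is needed about the decomposition: what `t` shares with the
    -- rest already lies in the bag of `p`. Every separation demand on the new leaf thus becomes one
    -- on the node holding `p`, which satisfies it already.
    grafted-separated : ∀ {O T T′} → Grafted p t T T′ →
      (∀ {v} → v ∈ bagList t → O v ⊎ AnyT (Occurs v) T → v ∈ bagList p) →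
      SeparatedB O T → SeparatedB O T′
    grafted-separated {O} {node S x l r} here trace (j , sl , sr) =
      record { Joint j hiding (separates; right⊆)
             ; separates = λ o a → separates o (Sum.[ id , (λ v∈t → here (trace v∈t (inj₁ o))) ]′ (grafted-occurs here a))
             ; right⊆    = id } ,
      separated-mono Occurs vertices l outˡ sl ,
      record { small     = length-bagList p
             ; separates = sepʳ
             ; top⊆      = id
             ; left⊆     = λ v∈ → proj₂ (∈-filter⁻ (_∈? bagList p) {xs = bagList t} v∈)
             ; right⊆    = right⊆ } ,
      (record { small     = ≤-trans (List.length-filter (_∈? bagList p) (bagList t)) (length-bagList t)
              ; separates = λ { o (here v∈t) → ∈-filter⁺ (_∈? bagList p) v∈t (leaf v∈t o) }
              ; top⊆      = λ v∈ → proj₁ (∈-filter⁻ (_∈? bagList p) {xs = bagList t} v∈)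
              ; left⊆     = λ ()
              ; right⊆    = λ () } , tt , tt) ,
      separated-mono Occurs vertices r outʳ sr
      where
      open Joint j
      around : ∀ {v} → v ∈ bagList t → O v ⊎ v ∈ bagList p ⊎ AnyT (Occurs v) l → v ∈ bagList p
      around v∈t (inj₁ o)        = trace v∈t (inj₁ o)
      around v∈t (inj₂ (inj₁ m)) = m
      around v∈t (inj₂ (inj₂ a)) = trace v∈t (inj₂ (left a))

      leaf : ∀ {v} → v ∈ bagList t → (O v ⊎ v ∈ bagList p ⊎ AnyT (Occurs v) l) ⊎ v ∈ bagList p ⊎ AnyT (Occurs v) r →
             v ∈ bagList p
      leaf v∈t (inj₁ o)        = around v∈t o
      leaf v∈t (inj₂ (inj₁ m)) = m
      leaf v∈t (inj₂ (inj₂ a)) = trace v∈t (inj₂ (right a))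

      sepʳ : ∀ {v} → O v ⊎ v ∈ bagList p ⊎ AnyT (Occurs v) l →
             AnyT (Occurs v) (node (bagList p) (p , []) (node (old p t) (t , new p t) nil nil) r) → v ∈ bagList p
      sepʳ o (here m)         = m
      sepʳ o (left (here m))  = around m o
      sepʳ o (left (left ()))
      sepʳ o (left (right ()))
      sepʳ o (right a)        = right⊆ (separated-top Occurs vertices r sr o a)

      outˡ : ∀ {v} → O v ⊎ v ∈ bagList p ⊎
             AnyT (Occurs v) (node (bagList p) (p , []) (node (old p t) (t , new p t) nil nil) r) →
             AnyT (Occurs v) l → O v ⊎ v ∈ bagList p ⊎ AnyT (Occurs v) r
      outˡ (inj₁ o) a                              = inj₁ o
      outˡ (inj₂ (inj₁ m)) a                       = inj₂ (inj₁ m)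
      outˡ (inj₂ (inj₂ (here m))) a                = inj₂ (inj₁ m)
      outˡ (inj₂ (inj₂ (left (here m)))) a         = inj₂ (inj₁ (trace m (inj₂ (left a))))
      outˡ (inj₂ (inj₂ (left (left ())))) a
      outˡ (inj₂ (inj₂ (left (right ())))) a
      outˡ (inj₂ (inj₂ (right b))) a               = inj₂ (inj₂ b)

      outʳ : ∀ {v} → (O v ⊎ v ∈ bagList p ⊎ AnyT (Occurs v) l) ⊎ v ∈ bagList p ⊎
             AnyT (Occurs v) (node (old p t) (t , new p t) nil nil) →
             AnyT (Occurs v) r → O v ⊎ v ∈ bagList p ⊎ AnyT (Occurs v) l
      outʳ (inj₁ o) a               = o
      outʳ (inj₂ (inj₁ m)) a        = inj₂ (inj₁ m)
      outʳ (inj₂ (inj₂ (here m))) a = inj₂ (inj₁ (trace m (inj₂ (right a))))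
    grafted-separated {O} {node S x l r} (left {l′ = l′} g) trace (j , sl , sr) =
      record { Joint j hiding (separates; left⊆)
             ; separates = λ o a → Joint.separates j o
                 (Sum.[ id , (λ v∈t → left (grafted-parent g (trace v∈t (inj₁ o)))) ]′ (grafted-occurs (left g) a))
             ; left⊆     = λ {v} v∈ → Joint.left⊆ j (subst (v ∈_) (grafted-top g) v∈) } ,
      grafted-separated g inside sl ,
      separated-mono Occurs vertices r outside sr
      where
      inside : ∀ {v} → v ∈ bagList t → (O v ⊎ Occurs v x ⊎ AnyT (Occurs v) r) ⊎ AnyT (Occurs v) l → v ∈ bagList p
      inside v∈t (inj₁ (inj₁ o))        = trace v∈t (inj₁ o)
      inside v∈t (inj₁ (inj₂ (inj₁ m))) = trace v∈t (inj₂ (here m))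
      inside v∈t (inj₁ (inj₂ (inj₂ a))) = trace v∈t (inj₂ (right a))
      inside v∈t (inj₂ a)               = trace v∈t (inj₂ (left a))

      outside : ∀ {v} → O v ⊎ Occurs v x ⊎ AnyT (Occurs v) l′ → AnyT (Occurs v) r →
                O v ⊎ Occurs v x ⊎ AnyT (Occurs v) l
      outside (inj₁ o) a        = inj₁ o
      outside (inj₂ (inj₁ m)) a = inj₂ (inj₁ m)
      outside (inj₂ (inj₂ b)) a with grafted-occurs g b
      ... | inj₁ b′  = inj₂ (inj₂ b′)
      ... | inj₂ v∈t = inj₂ (inj₂ (grafted-parent g (trace v∈t (inj₂ (right a)))))
    grafted-separated {O} {node S x l r} (right {r′ = r′} g) trace (j , sl , sr) =
      record { Joint j hiding (separates; right⊆)
             ; separates = λ o a → Joint.separates j o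
                 (Sum.[ id , (λ v∈t → right (grafted-parent g (trace v∈t (inj₁ o)))) ]′ (grafted-occurs (right g) a))
             ; right⊆    = λ {v} v∈ → Joint.right⊆ j (subst (v ∈_) (grafted-top g) v∈) } ,
      separated-mono Occurs vertices l outside sl ,
      grafted-separated g inside sr
      where
      inside : ∀ {v} → v ∈ bagList t → (O v ⊎ Occurs v x ⊎ AnyT (Occurs v) l) ⊎ AnyT (Occurs v) r → v ∈ bagList p
      inside v∈t (inj₁ (inj₁ o))        = trace v∈t (inj₁ o)
      inside v∈t (inj₁ (inj₂ (inj₁ m))) = trace v∈t (inj₂ (here m))
      inside v∈t (inj₁ (inj₂ (inj₂ a))) = trace v∈t (inj₂ (left a))
      inside v∈t (inj₂ a)               = trace v∈t (inj₂ (right a))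

      outside : ∀ {v} → O v ⊎ Occurs v x ⊎ AnyT (Occurs v) r′ → AnyT (Occurs v) l →
                O v ⊎ Occurs v x ⊎ AnyT (Occurs v) r
      outside (inj₁ o) a        = inj₁ o
      outside (inj₂ (inj₁ m)) a = inj₂ (inj₁ m)
      outside (inj₂ (inj₂ b)) a with grafted-occurs g b
      ... | inj₁ b′  = inj₂ (inj₂ b′)
      ... | inj₂ v∈t = inj₂ (inj₂ (grafted-parent g (trace v∈t (inj₂ (left a)))))

  -- `reach` keeps the visited nodes connected, so that two of them are joined by a walk avoiding
  -- any unvisited node. `introduced` is free of repetitions, so `total-load` is at most `n` however
  -- many nodes there are.
  record Grown (root : Fin nodes) (vis : List (Fin nodes)) : Set where
    field
      fresh      : Unique vis
      root∈      : root ∈ vis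
      reach      : ∀ {s} → s ∈ vis → Walk tree (_∈ vis) root s
      grown      : Tree Label
      holds      : ∀ {s} → s ∈ vis → AnyT (Holds s) grown
      occurs     : ∀ {v} → AnyT (Occurs v) grown → ∃ λ s → s ∈ vis × v ∈ bagList s
      separated  : SeparatedB (λ _ → ⊥) grown
      introduces : AllT Introduces grown
      loads      : AllT (λ _ x → load x ≤ K) grown
      introduced : List (Fin n)
      distinct   : Unique introduced
      present    : ∀ {v} → v ∈ introduced → AnyT (Occurs v) grown
      total-load : weigh load grown ≡ length introduced

  sprout : ∀ root → Grown root (root ∷ [])
  sprout root = record
    { fresh      = [] ∷ []
    ; root∈      = here refl
    ; reach      = λ { (here refl) → ε }
    ; grown      = node [] (root , bagList root) nil nil
    ; holds      = λ { (here refl) → here refl }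
    ; occurs     = λ { (here v∈) → root , here refl , v∈ }
    ; separated  = record { small = z≤n ; separates = λ () ; top⊆ = λ () ; left⊆ = λ () ; right⊆ = λ () } , tt , tt
    ; introduces = node ∈-++⁺ˡ nil nil
    ; loads      = node (length-bagList root) nil nil
    ; introduced = bagList root
    ; distinct   = elements-unique (bag root)
    ; present    = here
    ; total-load = +-identityʳ _
    }

  acyclic = IsTree.acyclic isTree

  -- In the tree, every walk from t into vis enters through p.
  trace-enters : ∀ {root vis p t} → Grown root vis → p ∈ vis → t ∉ vis → Adj tree p t →
                 ∀ {v s} → s ∈ vis → v ∈ₛ bag s → v ∈ₛ bag t → v ∈ₛ bag p
  trace-enters {vis = vis} {p} {t} grown p∈ t∉ e {v} {s} s∈ v∈s v∈t =
    go (walk-map tree avoids (walk-sym tree (Grown.reach grown p∈) ◅◅ Grown.reach grown s∈)) (avoids s∈)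
       (connectedTraces v v∈s v∈t)
    where
    avoids : ∀ {x} → x ∈ vis → t ≢ x
    avoids x∈ refl = t∉ x∈

    go : ∀ {q} → Walk tree (t ≢_) p q → t ≢ q → Walk tree (λ x → v ∈ₛ bag x) q t → v ∈ₛ bag p
    go walk t≢q ε = ⊥-elim (t≢q refl)
    go {q} walk t≢q (_◅_ {j = x} (v∈q , v∈x , qx) rest) with t Fin.≟ x
    ... | yes refl = subst (λ y → v ∈ₛ bag y)
                       (sym (neighbours-separated tree acyclic (Graph.symmetric tree e) (Graph.symmetric tree qx) walk)) v∈q
    ... | no  t≢x  = go (walk ◅◅ (t≢q , t≢x , qx) ◅ ε) t≢x rest

  extend : ∀ {root vis p t} → Grown root vis → p ∈ vis → t ∉ vis → Adj tree p t → Grown root (t ∷ vis)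
  extend {root} {vis} {p} {t} T p∈ t∉ e with graft t (Grown.holds T p∈)
  ... | T′ , g = record
    { fresh      = All.¬Any⇒All¬ _ t∉ ∷ fresh
    ; root∈      = there root∈
    ; reach      = λ where
        (here refl) → widen (reach p∈) ◅◅ (there p∈ , here refl , e) ◅ ε
        (there s∈)  → widen (reach s∈)
    ; grown      = T′
    ; holds      = λ where
        (here refl) → grafted-new g
        (there s∈)  → grafted-keeps g (holds s∈)
    ; occurs     = occurs′
    ; separated  = grafted-separated g (λ v∈t → Sum.[ (λ ()) , trace v∈t ]′) separated
    ; introduces = grafted-all g id (old⊎new p t) introduces
    ; loads      = grafted-all g z≤n
                     (≤-trans (List.length-filter (λ v → ¬? (v ∈? bagList p)) (bagList t)) (length-bagList t)) loads
    ; introduced = new p t ++ introduced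
    -- A vertex of `t` that had occurred before would lie in the bag of `p` by `trace`, and `new`
    -- excludes that bag.
    ; distinct   = Unique.++⁺ (Unique.filter⁺ (λ v → ¬? (v ∈? bagList p)) (elements-unique (bag t))) distinct
                     λ (v∈new , v∈) → let v∈t , v∉p = new⁻ v∈new in v∉p (trace v∈t (present v∈))
    ; present    = λ v∈ → Sum.[ (λ v∈new → mapAnyT (λ eq → subst (λ s → _ ∈ bagList s) (sym eq) (proj₁ (new⁻ v∈new))) (grafted-new g)) ,
                                (λ v∈ → grafted-keeps g (present v∈)) ]′ (∈-++⁻ (new p t) v∈)
    ; total-load = trans (grafted-load g) (trans (cong (length (new p t) +_) total-load)
                     (sym (List.length-++ (new p t))))
    }
    where
    open Grown T
    widen : ∀ {x y} → Walk tree (_∈ vis) x y → Walk tree (_∈ t ∷ vis) x y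
    widen = walk-map tree there

    trace : ∀ {v} → v ∈ bagList t → AnyT (Occurs v) grown → v ∈ bagList p
    trace v∈t a = let s , s∈ , v∈s = occurs a in
      ∈-elements⁺ (trace-enters T p∈ t∉ e s∈ (∈-elements⁻ (bag s) v∈s) (∈-elements⁻ (bag t) v∈t))

    occurs′ : ∀ {v} → AnyT (Occurs v) T′ → ∃ λ s → s ∈ t ∷ vis × v ∈ bagList s
    occurs′ a with grafted-occurs g a
    ... | inj₁ a′  = let s , s∈ , v∈s = occurs a′ in s , there s∈ , v∈s
    ... | inj₂ v∈t = t , here refl , v∈t

    new⁻ : ∀ {v} → v ∈ new p t → v ∈ bagList t × v ∉ bagList p
    new⁻ = ∈-filter⁻ (λ v → ¬? (v ∈? bagList p)) {xs = bagList t}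

  -- The fuel exceeds the number of unvisited nodes. At fuel zero the repetition-free list `vis`
  -- would be longer than `nodes`.
  grow : ∀ fuel {root vis} → Grown root vis → nodes < fuel + length vis →
         ∃ λ vis → Grown root vis × (∀ t → t ∈ vis)
  grow zero T m< = ⊥-elim (<⇒≱ m< (unique-length (Grown.fresh T)))
  grow (suc f) {root} {vis} T m< with Fin.all? (Nodes._∈? vis)
  ... | yes all = vis , T , all
  ... | no ¬all with Fin.¬∀⟶∃¬ nodes (_∈ vis) (Nodes._∈? vis) ¬all
  ...   | t , t∉ with crossing-edge tree (Grown.root∈ T) t∉ (IsTree.connected isTree tt tt)
  ...     | p , q , p∈ , q∉ , e = grow f (extend T p∈ q∉ e) (subst (nodes <_) (sym (+-suc f (length vis))) m<)

-- Two-layer drawings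

lookup-index′ : ∀ {A : Set} {x : A} {xs} → x ∈ xs → ∃ λ i → lookup xs i ≡ x
lookup-index′ (here refl) = zero , refl
lookup-index′ (there x∈)  = let i , eq = lookup-index′ x∈ in suc i , eq

length-cartesianProductWith : ∀ {A B C : Set} (f : A → B → C) xs ys →
                              length (cartesianProductWith f xs ys) ≡ length xs * length ys
length-cartesianProductWith f []       ys = refl
length-cartesianProductWith f (x ∷ xs) ys = trans (List.length-++ (map (f x) ys))
  (cong₂ _+_ (List.length-map (f x) ys) (length-cartesianProductWith f xs ys))

Cell : Set
Cell = ℕ × ℕ × Bool

-- Transposing also exchanges the layers, so that columns, in layer `true`, turn into rows, in layer
-- `false`, and the convention survives every level.
swap : Cell → Cell
swap (x , y , b) = y , x , not b

eastward northward : ℕ → Cell → Cell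
eastward n (x , y , b) = n + x , y , b
northward    n (x , y , b) = x , n + y , b

data _↝_ : Cell → Cell → Set where
  east  : ∀ {x y b} → (x , y , b) ↝ (suc x , y , b)
  north : ∀ {x y b} → (x , y , b) ↝ (x , suc y , b)
  via   : ∀ {x y} → (x , y , false) ↝ (x , y , true)

infix 4 _≈_ _↝_

_≈_ : Cell → Cell → Set
p ≈ q = p ↝ q ⊎ q ↝ p

↝-right : ∀ n {p q} → p ↝ q → eastward n p ↝ eastward n q
↝-right n {q = suc x , y , b} east rewrite +-suc n x = east
↝-right n north = north
↝-right n via = via

↝-up : ∀ n {p q} → p ↝ q → northward n p ↝ northward n q
↝-up n east = east
↝-up n {q = x , suc y , b} north rewrite +-suc n y = north
↝-up n via = via

≈-right : ∀ n {p q} → p ≈ q → eastward n p ≈ eastward n q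
≈-right n = Sum.map (↝-right n) (↝-right n)

≈-up : ∀ n {p q} → p ≈ q → northward n p ≈ northward n q
≈-up n = Sum.map (↝-up n) (↝-up n)

≈-swap : ∀ {p q} → p ≈ q → swap p ≈ swap q
≈-swap (inj₁ east)  = inj₁ north
≈-swap (inj₁ north) = inj₁ east
≈-swap (inj₁ via)   = inj₂ via
≈-swap (inj₂ east)  = inj₂ north
≈-swap (inj₂ north) = inj₂ east
≈-swap (inj₂ via)   = inj₁ via

Path : (Cell → Set) → Cell → Cell → Set
Path D = Star (λ p q → D p × D q × p ≈ q)

path-sym : ∀ {D p q} → Path D p q → Path D q p
path-sym = Star.reverse λ (dp , dq , p≈q) → dq , dp , Sum.swap p≈q

path-map : ∀ {D E : Cell → Set} (f : Cell → Cell) → (∀ {p} → D p → E (f p)) →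
           (∀ {p q} → p ≈ q → f p ≈ f q) → ∀ {p q} → Path D p q → Path E (f p) (f q)
path-map f D⇒E mono = Star.gmap f λ (dp , dq , p≈q) → D⇒E dp , D⇒E dq , mono p≈q

module _ {V : Set} where

  -- Indexed by positions in `T`, as lists of ports may repeat a vertex. A repeated vertex gets
  -- several columns, which have to be joined by its rows later.
  data Column (h : ℕ) (T : List V) : Cell → V → Set where
    column : ∀ i {y} → y < h → Column h T (toℕ i , y , true) (lookup T i)

  columns : ℕ → List V → List (Cell × V)
  columns h T = cartesianProductWith (λ i y → (toℕ i , y , true) , lookup T i) (allFin (length T)) (upTo h)

  ∈-columns⁺ : ∀ {h T p v} → Column h T p v → (p , v) ∈ columns h T
  ∈-columns⁺ (column i y<h) = ∈-cartesianProductWith⁺ _ (∈-allFin i) (∈-upTo⁺ y<h)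

  ∈-columns⁻ : ∀ {h T p v} → (p , v) ∈ columns h T → Column h T p v
  ∈-columns⁻ {h} {T} m with ∈-cartesianProductWith⁻ _ (allFin (length T)) (upTo h) m
  ... | i , y , _ , y∈ , refl = column i (∈-upTo⁻ y∈)

  length-columns : ∀ h T → length (columns h T) ≡ length T * h
  length-columns h T = trans (length-cartesianProductWith _ (allFin (length T)) (upTo h))
    (cong₂ _*_ (List.length-tabulate {n = length T} id) (List.length-upTo h))

  column-unique : ∀ {h h′ T p q u v} → p ≡ q → Column h T p u → Column h′ T q v → u ≡ v
  column-unique {T = T} eq (column i _) (column j _) = cong (lookup T) (Fin.toℕ-injective (cong proj₁ eq))

  column-down : ∀ {h T} i {y} → y < h → Path (λ p → Column h T p (lookup T i)) (toℕ i , y , true) (toℕ i , 0 , true)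
  column-down i {zero}  y<h = ε
  column-down i {suc y} y<h =
    let y<h′ = <-trans (n<1+n y) y<h in
    (column i y<h , column i y<h′ , inj₂ north) ◅ column-down i y<h′

  column-linked : ∀ {h T} i {y z} → y < h → z < h →
                  Path (λ p → Column h T p (lookup T i)) (toℕ i , y , true) (toℕ i , z , true)
  column-linked i y<h z<h = column-down i y<h ◅◅ path-sym (column-down i z<h)

module Drawing {V : Set} (_≟_ : DecidableEquality V) (W : ℕ) where

  open DecMembership _≟_ using (_∈?_)

  -- A unit of level 0 is a chunk of vertices; a unit of level k + 1 groups units of level k,
  -- each with the list of vertices that it shares with the outside.
  Hier : ℕ → Set
  Hier zero    = List V
  Hier (suc k) = List (Hier k × List V)

  tracks : ∀ k → Hier k → List V
  tracks zero    T = T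
  tracks (suc k) I = concatMap proj₂ I

  scale : ℕ → ℕ
  scale zero    = W
  scale (suc k) = 8 * scale k

  -- Two-layer wiring: rows run in layer false, columns in layer true.  A chunk is a crossbar.
  -- A larger unit stacks its children vertically, prolongs their rows to the left, and crosses
  -- these with one column per shared vertex.  The final swap turns these columns into rows that
  -- start at the left margin, so lengths grow alternately in the two directions: a unit of
  -- level k has width at most 63 * scale k and height at most scale (suc k).
  draw : ∀ k → Hier k → List (Cell × V)
  stack : ∀ k → List (Hier k × List V) → List (Cell × V)
  draw zero    T = columns (length T) T ++ map (map₁ swap) (columns (length T) T)
  draw (suc k) I = map (map₁ swap) (columns (63 * scale (suc k)) (concatMap proj₂ I) ++ stack k I)
  stack k []            = []
  stack k ((c , P) ∷ I) =
    map (map₁ swap) (columns W (tracks k c)) ++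
    map (map₁ (eastward W)) (draw k c) ++
    map (map₁ (northward (scale (suc k)))) (stack k I)

  -- Inductive forms of membership in `draw` and `stack`: the lists serve for counting cells, these
  -- for case analysis.
  data Drawn : ∀ k → Hier k → Cell → V → Set
  data Stacked (k : ℕ) : List (Hier k × List V) → Cell → V → Set

  data Drawn where
    vertical   : ∀ {T p v} → Column (length T) T p v → Drawn zero T p v
    horizontal : ∀ {T p v} → Column (length T) T p v → Drawn zero T (swap p) v
    track      : ∀ {k I p v} → Column (63 * scale (suc k)) (concatMap proj₂ I) p v → Drawn (suc k) I (swap p) v
    child      : ∀ {k I p v} → Stacked k I p v → Drawn (suc k) I (swap p) v

  data Stacked k where
    port  : ∀ {c P I p v} → Column W (tracks k c) p v → Stacked k ((c , P) ∷ I) (swap p) v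
    inner : ∀ {c P I p v} → Drawn k c p v → Stacked k ((c , P) ∷ I) (eastward W p) v
    above : ∀ {c P I p v} → Stacked k I p v → Stacked k ((c , P) ∷ I) (northward (scale (suc k)) p) v

  ∈-draw⁺ : ∀ {k c p v} → Drawn k c p v → (p , v) ∈ draw k c
  ∈-stack⁺ : ∀ {k I p v} → Stacked k I p v → (p , v) ∈ stack k I
  ∈-draw⁺ (vertical m)   = ∈-++⁺ˡ (∈-columns⁺ m)
  ∈-draw⁺ {c = T} (horizontal m) = ∈-++⁺ʳ (columns (length T) T) (∈-map⁺ (map₁ swap) (∈-columns⁺ m))
  ∈-draw⁺ (track m)      = ∈-map⁺ (map₁ swap) (∈-++⁺ˡ (∈-columns⁺ m))
  ∈-draw⁺ {suc k} {I} (child m) =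
    ∈-map⁺ (map₁ swap) (∈-++⁺ʳ (columns (63 * scale (suc k)) (concatMap proj₂ I)) (∈-stack⁺ m))
  ∈-stack⁺ (port m)  = ∈-++⁺ˡ (∈-map⁺ (map₁ swap) (∈-columns⁺ m))
  ∈-stack⁺ {k} {(c , P) ∷ I} (inner m) = ∈-++⁺ʳ (map (map₁ swap) (columns W (tracks k c)))
    (∈-++⁺ˡ (∈-map⁺ (map₁ (eastward W)) (∈-draw⁺ m)))
  ∈-stack⁺ {k} {(c , P) ∷ I} (above m) = ∈-++⁺ʳ (map (map₁ swap) (columns W (tracks k c)))
    (∈-++⁺ʳ (map (map₁ (eastward W)) (draw k c)) (∈-map⁺ (map₁ (northward (scale (suc k)))) (∈-stack⁺ m)))

  ∈-draw⁻ : ∀ k c {p v} → (p , v) ∈ draw k c → Drawn k c p v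
  ∈-stack⁻ : ∀ k I {p v} → (p , v) ∈ stack k I → Stacked k I p v
  ∈-draw⁻ zero T m with ∈-++⁻ (columns (length T) T) m
  ... | inj₁ m′ = vertical (∈-columns⁻ m′)
  ... | inj₂ m′ with ∈-map⁻ (map₁ swap) m′
  ...   | _ , m″ , refl = horizontal (∈-columns⁻ m″)
  ∈-draw⁻ (suc k) I m with ∈-map⁻ (map₁ swap) m
  ... | _ , m′ , refl with ∈-++⁻ (columns (63 * scale (suc k)) (concatMap proj₂ I)) m′
  ...   | inj₁ m″ = track (∈-columns⁻ m″)
  ...   | inj₂ m″ = child (∈-stack⁻ k I m″)
  ∈-stack⁻ k ((c , P) ∷ I) m with ∈-++⁻ (map (map₁ swap) (columns W (tracks k c))) m
  ... | inj₁ m′ with ∈-map⁻ (map₁ swap) m′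
  ...   | _ , m″ , refl = port (∈-columns⁻ m″)
  ∈-stack⁻ k ((c , P) ∷ I) m | inj₂ m′ with ∈-++⁻ (map (map₁ (eastward W)) (draw k c)) m′
  ... | inj₁ m″ with ∈-map⁻ (map₁ (eastward W)) m″
  ...   | _ , m‴ , refl = inner (∈-draw⁻ k c m‴)
  ∈-stack⁻ k ((c , P) ∷ I) m | inj₂ m′ | inj₂ m″ with ∈-map⁻ (map₁ (northward (scale (suc k)))) m″
  ...   | _ , m‴ , refl = above (∈-stack⁻ k I m‴)

  -- Contents of units, and disjointness inside a drawing

  Occ : V → ∀ k → Hier k → Set
  Occ v zero    T = v ∈ T
  Occ v (suc k) I = Any (λ x → Occ v k (proj₁ x)) I

  Together : V → V → ∀ k → Hier k → Set
  Together u v zero    T = u ∈ T × v ∈ T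
  Together u v (suc k) I = Any (λ x → Together u v k (proj₁ x)) I

  Coherent : ∀ k → (x y : Hier k × List V) → Set
  Coherent k (c , P) (d , Q) = ∀ v → Occ v k c → Occ v k d → v ∈ P × v ∈ Q

  WellFormed : ∀ k → Hier k → Set
  WellFormed zero    T = length T ≤ W
  WellFormed (suc k) I =
    length I ≤ 63 × length (concatMap proj₂ I) ≤ W ×
    All (λ x → WellFormed k (proj₁ x) × proj₂ x ⊆ tracks k (proj₁ x)) I × AllPairs (Coherent k) I

  Children : ∀ k → List (Hier k × List V) → Set
  Children k = All (λ x → WellFormed k (proj₁ x) × proj₂ x ⊆ tracks k (proj₁ x))

  length-tracks : ∀ k c → WellFormed k c → length (tracks k c) ≤ W
  length-tracks zero    T wf = wf
  length-tracks (suc k) I (_ , wf , _) = wf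

  tracks⇒occ : ∀ k c → WellFormed k c → ∀ {v} → v ∈ tracks k c → Occ v k c
  ports⇒occ : ∀ k I → Children k I → ∀ {v} → v ∈ concatMap proj₂ I → Occ v (suc k) I
  tracks⇒occ zero    T wf v∈ = v∈
  tracks⇒occ (suc k) I (_ , _ , wfs , _) = ports⇒occ k I wfs
  ports⇒occ k ((c , P) ∷ I) ((wf , P⊆) ∷ wfs) v∈ with ∈-++⁻ P v∈
  ... | inj₁ v∈P = here (tracks⇒occ k c wf (P⊆ v∈P))
  ... | inj₂ v∈I = there (ports⇒occ k I wfs v∈I)

  column⇒∈ : ∀ {h} {T : List V} {p v} → Column h T p v → v ∈ T
  column⇒∈ {T = T} (column i _) = ∈-lookup {xs = T} i

  drawn⇒occ : ∀ k c → WellFormed k c → ∀ {p v} → Drawn k c p v → Occ v k c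
  stacked⇒occ : ∀ k I → Children k I → ∀ {p v} → Stacked k I p v → Occ v (suc k) I
  drawn⇒occ zero T wf (vertical m)   = column⇒∈ m
  drawn⇒occ zero T wf (horizontal m) = column⇒∈ m
  drawn⇒occ (suc k) I (_ , _ , wfs , _) (track m) = ports⇒occ k I wfs (column⇒∈ m)
  drawn⇒occ (suc k) I (_ , _ , wfs , _) (child m) = stacked⇒occ k I wfs m
  stacked⇒occ k ((c , P) ∷ I) ((wf , _) ∷ wfs) (port m)  = here (tracks⇒occ k c wf (column⇒∈ m))
  stacked⇒occ k ((c , P) ∷ I) ((wf , _) ∷ wfs) (inner m) = here (drawn⇒occ k c wf m)
  stacked⇒occ k ((c , P) ∷ I) (_ ∷ wfs)        (above m) = there (stacked⇒occ k I wfs m)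

  W≤scale : ∀ k → W ≤ scale k
  W≤scale zero    = ≤-refl
  W≤scale (suc k) = ≤-trans (W≤scale k) (m≤m+n (scale k) _)

  positive-scale : ∀ k {j} → j < W → 0 < 63 * scale k
  positive-scale k j<W = <-≤-trans (≤-<-trans z≤n j<W) (≤-trans (W≤scale k) (m≤m+n (scale k) _))

  InBox : ℕ → ℕ → Cell → Set
  InBox w h (x , y , _) = x < w × y < h

  drawn-inBox : ∀ k c → WellFormed k c → ∀ {p v} → Drawn k c p v → InBox (63 * scale k) (scale (suc k)) p
  stacked-inBox : ∀ k I → Children k I → ∀ {p v} → Stacked k I p v →
                  InBox (W + 63 * scale k) (length I * scale (suc k)) p
  drawn-inBox zero T wf (vertical (column i y<)) =
    <-≤-trans (<-≤-trans (Fin.toℕ<n i) wf) (m≤m+n W _) , <-≤-trans (<-≤-trans y< wf) (m≤m+n W _)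
  drawn-inBox zero T wf (horizontal (column i y<)) =
    <-≤-trans (<-≤-trans y< wf) (m≤m+n W _) , <-≤-trans (<-≤-trans (Fin.toℕ<n i) wf) (m≤m+n W _)
  drawn-inBox (suc k) I (_ , tr≤ , _) (track (column i y<)) =
    y< , <-≤-trans (<-≤-trans (Fin.toℕ<n i) tr≤) (W≤scale (suc (suc k)))
  drawn-inBox (suc k) I (I≤ , _ , wfs , _) (child m) =
    let x< , y< = stacked-inBox k I wfs m in
    <-≤-trans y< (*-monoˡ-≤ (scale (suc k)) I≤) , <-≤-trans x< lemma
    where
    -- The strip of width `W` in front of the children costs at most one more `scale k`, and 1 + 63
    -- is exactly 8 * 8. This is why a unit has at most 63 children rather than 64.
    lemma : W + 63 * scale k ≤ 8 * (8 * scale k)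
    lemma = ≤-trans (+-monoˡ-≤ (63 * scale k) (W≤scale k)) (≤-reflexive (*-assoc 8 8 (scale k)))
  stacked-inBox k ((c , P) ∷ I) ((wf , _) ∷ _) (port (column i y<)) =
    <-≤-trans y< (m≤m+n W _) ,
    <-≤-trans (Fin.toℕ<n i) (≤-trans (length-tracks k c wf) (≤-trans (W≤scale (suc k)) (m≤m+n (scale (suc k)) _)))
  stacked-inBox k ((c , P) ∷ I) ((wf , _) ∷ _) (inner m) =
    let x< , y< = drawn-inBox k c wf m in +-monoʳ-< W x< , <-≤-trans y< (m≤m+n (scale (suc k)) _)
  stacked-inBox k ((c , P) ∷ I) (_ ∷ wfs) (above m) =
    let x< , y< = stacked-inBox k I wfs m in x< , +-monoʳ-< (scale (suc k)) y<

  -- In the strip left of abscissa `W` a stack uses only layer `false`, for the prolonged rows.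
  -- Layer `true` is free there for the tracks that cross them.
  stacked-clear : ∀ {k I p v} → Stacked k I p v → proj₂ (proj₂ p) ≡ false ⊎ W ≤ proj₁ p
  stacked-clear (port (column _ _)) = inj₁ refl
  stacked-clear (inner m) = inj₂ (m≤m+n W _)
  stacked-clear (above m) = stacked-clear m

  swap-injective : ∀ {p q} → swap p ≡ swap q → p ≡ q
  swap-injective {_ , _ , false} {_ , _ , false} refl = refl
  swap-injective {_ , _ , true}  {_ , _ , true}  refl = refl

  right-injective : ∀ n {p q} → eastward n p ≡ eastward n q → p ≡ q
  right-injective n eq = cong₂ _,_ (+-cancelˡ-≡ n _ _ (cong proj₁ eq)) (cong proj₂ eq)

  up-injective : ∀ n {p q} → northward n p ≡ northward n q → p ≡ q
  up-injective n eq = cong₂ _,_ (cong proj₁ eq)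
    (cong₂ _,_ (+-cancelˡ-≡ n _ _ (cong (proj₁ ∘ proj₂) eq)) (cong (proj₂ ∘ proj₂) eq))

  column∩stacked : ∀ {k I h} {T : List V} {p q u v} → length T ≤ W → p ≡ q → Column h T p u → Stacked k I q v → ⊥
  column∩stacked T≤ refl (column i _) m with stacked-clear m
  ... | inj₁ ()
  ... | inj₂ W≤i = <⇒≱ (<-≤-trans (Fin.toℕ<n i) T≤) W≤i

  -- Any two pieces of a drawing are separated by their layers or by disjoint boxes. The cells are
  -- related by `p ≡ q` because indices such as `swap p` and `northward n p` do not unify.
  drawn-unique : ∀ k c → WellFormed k c → ∀ {p q u v} → p ≡ q → Drawn k c p u → Drawn k c q v → u ≡ v
  stacked-unique : ∀ k I → Children k I → ∀ {p q u v} → p ≡ q → Stacked k I p u → Stacked k I q v → u ≡ v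
  drawn-unique zero T wf eq (vertical m) (vertical m′) = column-unique eq m m′
  drawn-unique zero T wf eq (vertical (column _ _)) (horizontal (column _ _)) with () ← cong (proj₂ ∘ proj₂) eq
  drawn-unique zero T wf eq (horizontal (column _ _)) (vertical (column _ _)) with () ← cong (proj₂ ∘ proj₂) eq
  drawn-unique zero T wf eq (horizontal m) (horizontal m′) = column-unique (swap-injective eq) m m′
  drawn-unique (suc k) I wf eq (track m) (track m′) = column-unique (swap-injective eq) m m′
  drawn-unique (suc k) I (_ , tr≤ , _) eq (track m) (child m′) = ⊥-elim (column∩stacked tr≤ (swap-injective eq) m m′)
  drawn-unique (suc k) I (_ , tr≤ , _) eq (child m) (track m′) =
    ⊥-elim (column∩stacked tr≤ (sym (swap-injective eq)) m′ m)
  drawn-unique (suc k) I (_ , _ , wfs , _) eq (child m) (child m′) = stacked-unique k I wfs (swap-injective eq) m m′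
  stacked-unique k (_ ∷ I) _ eq (port m) (port m′) = column-unique (swap-injective eq) m m′
  stacked-unique k (_ ∷ I) _ eq (port (column _ y<)) (inner _) =
    ⊥-elim (<⇒≱ y< (≤-trans (m≤m+n W _) (≤-reflexive (sym (cong proj₁ eq)))))
  stacked-unique k (_ ∷ I) _ eq (inner _) (port (column _ y<)) =
    ⊥-elim (<⇒≱ y< (≤-trans (m≤m+n W _) (≤-reflexive (cong proj₁ eq))))
  stacked-unique k ((c , _) ∷ I) ((wf , _) ∷ _) eq (port (column i _)) (above _) =
    ⊥-elim (<⇒≱ (<-≤-trans (Fin.toℕ<n i) (≤-trans (length-tracks k c wf) (W≤scale (suc k))))
      (≤-trans (m≤m+n (scale (suc k)) _) (≤-reflexive (sym (cong (proj₁ ∘ proj₂) eq)))))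
  stacked-unique k ((c , _) ∷ I) ((wf , _) ∷ _) eq (above _) (port (column i _)) =
    ⊥-elim (<⇒≱ (<-≤-trans (Fin.toℕ<n i) (≤-trans (length-tracks k c wf) (W≤scale (suc k))))
      (≤-trans (m≤m+n (scale (suc k)) _) (≤-reflexive (cong (proj₁ ∘ proj₂) eq))))
  stacked-unique k ((c , _) ∷ I) ((wf , _) ∷ _) eq (inner m) (inner m′) =
    drawn-unique k c wf (right-injective W eq) m m′
  stacked-unique k ((c , _) ∷ I) ((wf , _) ∷ _) eq (inner m) (above _) =
    ⊥-elim (<⇒≱ (proj₂ (drawn-inBox k c wf m))
      (≤-trans (m≤m+n (scale (suc k)) _) (≤-reflexive (sym (cong (proj₁ ∘ proj₂) eq)))))
  stacked-unique k ((c , _) ∷ I) ((wf , _) ∷ _) eq (above _) (inner m) =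
    ⊥-elim (<⇒≱ (proj₂ (drawn-inBox k c wf m))
      (≤-trans (m≤m+n (scale (suc k)) _) (≤-reflexive (cong (proj₁ ∘ proj₂) eq))))
  stacked-unique k (_ ∷ I) (_ ∷ wfs) eq (above m) (above m′) =
    stacked-unique k I wfs (up-injective (scale (suc k)) eq) m m′

  -- The left end of each track, where the enclosing stack attaches the prolongation of the row.
  drawn-track : ∀ k c → WellFormed k c → ∀ i → Drawn k c (0 , toℕ i , false) (lookup (tracks k c) i)
  drawn-track zero    T wf i = horizontal (column i (≤-<-trans z≤n (Fin.toℕ<n i)))
  drawn-track (suc k) I (_ , tr≤ , _) i =
    track (column i (positive-scale (suc k) (<-≤-trans (Fin.toℕ<n i) tr≤)))

  drawn-inhabited : ∀ k c {v} → WellFormed k c → Occ v k c → ∃ λ p → Drawn k c p v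
  stacked-inhabited : ∀ k I {v} → Children k I → Occ v (suc k) I → ∃ λ p → Stacked k I p v
  drawn-inhabited zero T wf v∈ with lookup-index′ v∈
  ... | i , refl = _ , drawn-track zero T wf i
  drawn-inhabited (suc k) I (_ , _ , wfs , _) o = let p , m = stacked-inhabited k I wfs o in swap p , child m
  stacked-inhabited k ((c , _) ∷ I) ((wf , _) ∷ _) (here o) =
    let p , m = drawn-inhabited k c wf o in eastward W p , inner m
  stacked-inhabited k (_ ∷ I) (_ ∷ wfs) (there o) =
    let p , m = stacked-inhabited k I wfs o in northward (scale (suc k)) p , above m

  -- Inside a crossbar the column of `u` and the row of `v` pass through the same place in different
  -- layers; larger units only move this contact.
  drawn-touching : ∀ k c {u v} → Together u v k c → ∃₂ λ p q → Drawn k c p u × Drawn k c q v × p ≈ q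
  stacked-touching : ∀ k I {u v} → Together u v (suc k) I → ∃₂ λ p q → Stacked k I p u × Stacked k I q v × p ≈ q
  drawn-touching zero T (u∈ , v∈) with lookup-index′ u∈ | lookup-index′ v∈
  ... | i , refl | j , refl =
    (toℕ i , toℕ j , true) , (toℕ i , toℕ j , false) ,
    vertical (column i (Fin.toℕ<n j)) , horizontal (column j (Fin.toℕ<n i)) , inj₂ via
  drawn-touching (suc k) I t = let p , q , mp , mq , p≈q = stacked-touching k I t in
    swap p , swap q , child mp , child mq , ≈-swap p≈q
  stacked-touching k ((c , _) ∷ I) (here t) = let p , q , mp , mq , p≈q = drawn-touching k c t in
    eastward W p , eastward W q , inner mp , inner mq , ≈-right W p≈q
  stacked-touching k (_ ∷ I) (there t) = let p , q , mp , mq , p≈q = stacked-touching k I t in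
    northward (scale (suc k)) p , northward (scale (suc k)) q , above mp , above mq , ≈-up (scale (suc k)) p≈q

  -- Connectedness of the branch sets

  Connected : ∀ k → Hier k → Set
  Connected k c = ∀ {v p q} → Drawn k c p v → Drawn k c q v → Path (λ p → Drawn k c p v) p q

  -- One position `c` of the vertex is fixed. Every column of the same vertex crosses row `c` and
  -- every such row crosses column `c`, so all of them lead to the diagonal cell of `c`.
  leaf-linked : ∀ T → Connected zero T
  leaf-linked T {v} m m′ with lookup-index′ (drawn⇒occ′ m)
    where
    drawn⇒occ′ : ∀ {p} → Drawn zero T p v → v ∈ T
    drawn⇒occ′ (vertical m)   = column⇒∈ m
    drawn⇒occ′ (horizontal m) = column⇒∈ m
  ... | c , refl = to-hub m ◅◅ path-sym (to-hub m′)
    where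
    D : Cell → Set
    D p = Drawn zero T p (lookup T c)

    columnPath : ∀ i → lookup T i ≡ lookup T c → ∀ {y z} → y < length T → z < length T →
                 Path D (toℕ i , y , true) (toℕ i , z , true)
    columnPath i eq y< z< = path-map id (λ m → vertical (subst (Column _ T _) eq m)) id (column-linked i y< z<)

    rowPath : ∀ i → lookup T i ≡ lookup T c → ∀ {y z} → y < length T → z < length T →
              Path D (y , toℕ i , false) (z , toℕ i , false)
    rowPath i eq y< z< = path-map swap (λ m → horizontal (subst (Column _ T _) eq m)) ≈-swap (column-linked i y< z<)

    crossing : ∀ i j → lookup T i ≡ lookup T c → lookup T j ≡ lookup T c →
               Path D (toℕ i , toℕ j , true) (toℕ i , toℕ j , false)
    crossing i j eq eq′ =
      (vertical (subst (Column _ T _) eq (column i (Fin.toℕ<n j))) ,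
       horizontal (subst (Column _ T _) eq′ (column j (Fin.toℕ<n i))) , inj₂ via) ◅ ε

    hub : Cell
    hub = toℕ c , toℕ c , false

    from-column : ∀ {p u} → u ≡ lookup T c → Column (length T) T p u → Path D p hub
    from-column eq (column i y<) =
      columnPath i eq y< (Fin.toℕ<n c) ◅◅ crossing i c eq refl ◅◅ rowPath c refl (Fin.toℕ<n i) (Fin.toℕ<n c)

    from-row : ∀ {p u} → u ≡ lookup T c → Column (length T) T p u → Path D (swap p) hub
    from-row eq (column i y<) =
      rowPath i eq y< (Fin.toℕ<n c) ◅◅ path-sym (crossing c i refl eq) ◅◅
      columnPath c refl (Fin.toℕ<n i) (Fin.toℕ<n c) ◅◅ crossing c c refl refl

    to-hub : ∀ {p} → D p → Path D p hub
    to-hub (vertical m)   = from-column refl m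
    to-hub (horizontal m) = from-row refl m

  module _ {k : ℕ} {c : Hier k} {P : List V} {I : List (Hier k × List V)} (wf : WellFormed k c) where

    port-exit : ∀ i {x} → x < W → Path (λ p → Stacked k ((c , P) ∷ I) p (lookup (tracks k c) i))
                                       (x , toℕ i , false) (eastward W (0 , toℕ i , false))
    port-exit i {x} x<W with m≤n⇒∃[o]m+o≡n x<W
    -- Here `suc x + d` equals `W`, so `x + d` is the last abscissa of the strip and its eastern
    -- neighbour is the track's end in the child.
    ... | d , eq =
      path-map swap port ≈-swap (column-linked i x<W w<W) ◅◅
      (port (column i w<W) , inner (drawn-track k c wf i) ,
       inj₁ (subst (λ z → (x + d , toℕ i , false) ↝ (z , toℕ i , false))
                   (trans eq (sym (+-identityʳ W))) east)) ◅ ε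
      where
      w<W : x + d < W
      w<W = ≤-reflexive eq

  -- The row is unbroken across the whole strip, so it meets each track of the same vertex and can
  -- join repeated tracks.
  stack-row : ∀ k I → Children k I → ∀ {v} → v ∈ concatMap proj₂ I →
              ∃ λ y → y < length I * scale (suc k) × (∀ {x} → x < W → Stacked k I (x , y , false) v)
  stack-row k ((c , P) ∷ I) ((wf , P⊆) ∷ wfs) v∈ with ∈-++⁻ P v∈
  ... | inj₁ v∈P with lookup-index′ (P⊆ v∈P)
  ...   | i , refl = toℕ i , <-≤-trans (Fin.toℕ<n i) (≤-trans (length-tracks k c wf)
                        (≤-trans (W≤scale (suc k)) (m≤m+n (scale (suc k)) _))) , λ x<W → port (column i x<W)
  stack-row k ((c , P) ∷ I) ((wf , P⊆) ∷ wfs) v∈ | inj₂ v∈I with stack-row k I wfs v∈I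
  ...   | y , y< , row = scale (suc k) + y , +-monoʳ-< (scale (suc k)) y< , λ x<W → above (row x<W)

  coherent-head : ∀ {k c P I v} → All (Coherent k (c , P)) I → Occ v k c → Occ v (suc k) I →
                  v ∈ P × v ∈ concatMap proj₂ I
  coherent-head {I = (d , Q) ∷ I} (coh ∷ cohs) o (here o′) =
    let v∈P , v∈Q = coh _ o o′ in v∈P , ∈-++⁺ˡ v∈Q
  coherent-head {I = (d , Q) ∷ I} (coh ∷ cohs) o (there o′) =
    let v∈P , v∈I = coherent-head cohs o o′ in v∈P , ∈-++⁺ʳ Q v∈I

  path-above : ∀ {k c P I v p q} → Path (λ p → Stacked k I p v) p q →
               Path (λ p → Stacked k ((c , P) ∷ I) p v) (northward (scale (suc k)) p) (northward (scale (suc k)) q)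
  path-above = path-map (northward _) above (≈-up _)

  -- The cells of a port vertex all lead to the left end of one of its tracks. Coherence confines
  -- any other vertex to a single child, where induction applies.
  drawn-linked : ∀ k c → WellFormed k c → Connected k c

  inner-linked : ∀ k c {P I} → WellFormed k c → ∀ {v p q} → Drawn k c p v → Drawn k c q v →
                 Path (λ p → Stacked k ((c , P) ∷ I) p v) (eastward W p) (eastward W q)
  inner-linked k c wf m m′ = path-map (eastward W) inner (≈-right W) (drawn-linked k c wf m m′)

  -- A colour among the ports reaches the stack's left margin.
  stack-exit : ∀ k I → Children k I → AllPairs (Coherent k) I → ∀ {v p} → v ∈ concatMap proj₂ I →
               Stacked k I p v → ∃ λ y → y < length I * scale (suc k) ×
               (∀ {x} → x < W → Stacked k I (x , y , false) v × Path (λ p → Stacked k I p v) p (x , y , false))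

  stack-exit-head : ∀ k c P I → Children k ((c , P) ∷ I) → All (Coherent k (c , P)) I →
                    ∀ {v p} → v ∈ concatMap proj₂ ((c , P) ∷ I) → Drawn k c p v →
                    ∃ λ y → y < length ((c , P) ∷ I) * scale (suc k) ×
                    (∀ {x} → x < W → Stacked k ((c , P) ∷ I) (x , y , false) v ×
                      Path (λ p → Stacked k ((c , P) ∷ I) p v) (eastward W p) (x , y , false))
  stack-exit-head k c P I ((wf , P⊆) ∷ wfs) cohs {v} v∈ m with lookup-index′ (P⊆ v∈P)
    where
    v∈P : v ∈ P
    v∈P with ∈-++⁻ P v∈
    ... | inj₁ v∈P = v∈P
    -- A port of some other child occurs in that child, so coherence makes it a port of this one as
    -- well.
    ... | inj₂ v∈I = proj₁ (coherent-head cohs (drawn⇒occ k c wf m) (ports⇒occ k I wfs v∈I))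
  ... | i , refl = toℕ i , <-≤-trans (Fin.toℕ<n i) (≤-trans (length-tracks k c wf)
                        (≤-trans (W≤scale (suc k)) (m≤m+n (scale (suc k)) _))) , λ x<W →
    port (column i x<W) , inner-linked k c wf m (drawn-track k c wf i) ◅◅ path-sym (port-exit wf i x<W)

  stack-exit k ((c , P) ∷ I) wfs@((wf , _) ∷ _) (cohs ∷ _) v∈ (inner m) =
    stack-exit-head k c P I wfs cohs v∈ m
  stack-exit k ((c , P) ∷ I) wfs@((wf , _) ∷ _) (cohs ∷ _) v∈ (port (column i x<W)) =
    let y , y< , exit = stack-exit-head k c P I wfs cohs v∈ (drawn-track k c wf i) in
    y , y< , λ x<W′ → let m , path = exit x<W′ in m , port-exit wf i x<W ◅◅ path
  stack-exit k ((c , P) ∷ I) ((wf , P⊆) ∷ wfs) (cohs ∷ coh) {v} v∈ (above m) =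
    let y , y< , exit = stack-exit k I wfs coh v∈I m in
    scale (suc k) + y , +-monoʳ-< (scale (suc k)) y< ,
    λ x<W → let m′ , path = exit x<W in above m′ , path-above path
    where
    v∈I : v ∈ concatMap proj₂ I
    v∈I with ∈-++⁻ P v∈
    ... | inj₁ v∈P = proj₂ (coherent-head cohs (tracks⇒occ k c wf (P⊆ v∈P)) (stacked⇒occ k I wfs m))
    ... | inj₂ v∈I = v∈I

  -- A colour outside the ports lives in a single child.
  stack-linked : ∀ k I → Children k I → AllPairs (Coherent k) I → ∀ {v p q} → v ∉ concatMap proj₂ I →
                 Stacked k I p v → Stacked k I q v → Path (λ p → Stacked k I p v) p q
  stack-linked k ((c , P) ∷ I) ((wf , _) ∷ wfs) (cohs ∷ coh) {v} {p} {q} v∉ m m′ = join (side m) (side m′)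
    where
    D : Cell → Set
    D p = Stacked k ((c , P) ∷ I) p v

    Side : Cell → Set
    Side p = (∃ λ q → Drawn k c q v × Path D p (eastward W q)) ⊎
             (∃ λ q → p ≡ northward (scale (suc k)) q × Stacked k I q v)

    side : ∀ {p} → D p → Side p
    side (port (column i x<W)) = inj₁ (_ , drawn-track k c wf i , port-exit wf i x<W)
    side (inner m)             = inj₁ (_ , m , ε)
    side (above m)             = inj₂ (_ , refl , m)

    apart : ∀ {p q} → Drawn k c p v → Stacked k I q v → ⊥
    apart m m′ = v∉ (∈-++⁺ˡ (proj₁ (coherent-head cohs (drawn⇒occ k c wf m) (stacked⇒occ k I wfs m′))))

    join : ∀ {p q} → Side p → Side q → Path D p q
    join (inj₁ (_ , m , path)) (inj₁ (_ , m′ , path′)) = path ◅◅ inner-linked k c wf m m′ ◅◅ path-sym path′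
    join (inj₁ (_ , m , _))    (inj₂ (_ , _ , m′))     = ⊥-elim (apart m m′)
    join (inj₂ (_ , _ , m))    (inj₁ (_ , m′ , _))     = ⊥-elim (apart m′ m)
    join (inj₂ (_ , refl , m)) (inj₂ (_ , refl , m′))  = path-above (stack-linked k I wfs coh (v∉ ∘ ∈-++⁺ʳ P) m m′)

  module _ {k : ℕ} {I : Hier (suc k)} (wf : WellFormed (suc k) I) (c : Fin (length (concatMap proj₂ I))) where
    private
      I≤  = proj₁ wf
      tr≤ = proj₁ (proj₂ wf)
      wfs = proj₁ (proj₂ (proj₂ wf))
      coh = proj₂ (proj₂ (proj₂ wf))
      tr  = concatMap proj₂ I
      v   = lookup tr c

      D : Cell → Set
      D p = Drawn (suc k) I p v

      hub : Cell
      hub = 0 , toℕ c , false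

      v∈tr : v ∈ tr
      v∈tr = ∈-lookup {xs = tr} c

      short : ∀ {i : Fin (length tr)} → toℕ i < W
      short {i} = <-≤-trans (Fin.toℕ<n i) tr≤

    track-to-hub : ∀ {x} → x < 63 * scale (suc k) → Path D (swap (toℕ c , x , true)) hub
    track-to-hub x< = path-map swap track ≈-swap (column-down c x<)

    child-to-hub : ∀ {p} → Stacked k I p v → Path D (swap p) hub
    child-to-hub m with stack-exit k I wfs coh v∈tr m
    ... | y , y< , exit =
      let m′ , path = exit short
          y<′ = <-≤-trans y< (*-monoˡ-≤ (scale (suc k)) I≤) in
      path-map swap child ≈-swap path ◅◅
      (child m′ , track (column c y<′) , ≈-swap (inj₁ via)) ◅ track-to-hub y<′

    to-hub : ∀ {p u} → Drawn (suc k) I p u → u ≡ v → Path D p hub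
    to-hub (child m) refl = child-to-hub m
    -- Track `i` may be another track of the same vertex than `c`. It is followed up to a row of
    -- that vertex, from which `child-to-hub` leads on.
    to-hub (track (column i {x} x<)) eq with stack-row k I wfs v∈tr
    ... | y , y< , row =
      let y<′ = <-≤-trans y< (*-monoˡ-≤ (scale (suc k)) I≤) in
      path-map swap (λ m → subst (Drawn (suc k) I _) eq (track m)) ≈-swap (column-linked i x< y<′) ◅◅
      (subst (Drawn (suc k) I _) eq (track (column i y<′)) , child (row short) , ≈-swap (inj₂ via)) ◅
      child-to-hub (row short)

  drawn-linked zero    T wf m m′ = leaf-linked T m m′
  drawn-linked (suc k) I wf@(_ , _ , wfs , coh) {v} m m′ with v ∈? concatMap proj₂ I
  ... | yes v∈ with lookup-index′ v∈
  ...   | c , refl = to-hub wf c m refl ◅◅ path-sym (to-hub wf c m′ refl)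
  drawn-linked (suc k) I wf@(_ , _ , wfs , coh) {v} (track m) _ | no v∉ = ⊥-elim (v∉ (column⇒∈ m))
  drawn-linked (suc k) I wf@(_ , _ , wfs , coh) {v} (child m) (track m′) | no v∉ = ⊥-elim (v∉ (column⇒∈ m′))
  drawn-linked (suc k) I wf@(_ , _ , wfs , coh) {v} (child m) (child m′) | no v∉ =
    path-map swap child ≈-swap (stack-linked k I wfs coh v∉ m m′)

  -- Counting the cells of a drawing

  length-leaf : ∀ T → WellFormed zero T → length (draw zero T) ≤ 126 * (W * W)
  length-leaf T wf = begin
    length (columns (length T) T ++ map (map₁ swap) (columns (length T) T))
      ≡⟨ List.length-++ (columns (length T) T) ⟩
    length (columns (length T) T) + length (map (map₁ swap) (columns (length T) T))
      ≡⟨ cong (length (columns (length T) T) +_) (List.length-map (map₁ swap) (columns (length T) T)) ⟩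
    length (columns (length T) T) + length (columns (length T) T)
      ≡⟨ cong₂ _+_ (length-columns (length T) T) (length-columns (length T) T) ⟩
    length T * length T + length T * length T
      ≤⟨ +-mono-≤ (*-mono-≤ wf wf) (*-mono-≤ wf wf) ⟩
    W * W + W * W
      ≤⟨ +-monoʳ-≤ (W * W) (m≤m+n (W * W) _) ⟩
    126 * (W * W) ∎
    where open ≤-Reasoning

  total : ∀ k → List (Hier k × List V) → ℕ
  total k I = sum (map (λ x → length (draw k (proj₁ x))) I)

  length-stack : ∀ k I → Children k I → length (stack k I) ≤ length I * (W * W) + total k I
  length-stack k [] [] = z≤n
  length-stack k ((c , P) ∷ I) ((wf , _) ∷ wfs) = begin
    length (ports ++ body ++ rest)
      ≡⟨ trans (List.length-++ ports) (cong (length ports +_) (List.length-++ body)) ⟩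
    length ports + (length body + length rest)
      ≡⟨ cong₂ _+_ (trans (List.length-map _ (columns W (tracks k c))) (length-columns W (tracks k c)))
           (cong₂ _+_ (List.length-map _ (draw k c)) (List.length-map _ (stack k I))) ⟩
    length (tracks k c) * W + (length (draw k c) + length (stack k I))
      ≤⟨ +-mono-≤ (*-monoˡ-≤ W (length-tracks k c wf)) (+-monoʳ-≤ (length (draw k c)) (length-stack k I wfs)) ⟩
    W * W + (length (draw k c) + (length I * (W * W) + total k I))
      ≡⟨ cong (W * W +_) (x∙yz≈y∙xz +-commutativeSemigroup (length (draw k c)) (length I * (W * W)) (total k I)) ⟩
    W * W + (length I * (W * W) + (length (draw k c) + total k I))
      ≡⟨ +-assoc (W * W) (length I * (W * W)) _ ⟨
    length ((c , P) ∷ I) * (W * W) + total k ((c , P) ∷ I) ∎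
    where
    open ≤-Reasoning
    ports = map (map₁ swap) (columns W (tracks k c))
    body  = map (map₁ (eastward W)) (draw k c)
    rest  = map (map₁ (northward (scale (suc k)))) (stack k I)

  -- The tracks and the prolonged rows cost at most 63 times `W * scale (suc k)` each: at most `W`
  -- tracks of length `63 * scale (suc k)`, and 63 strips of at most `W * W` cells. Their sum gives
  -- 126.
  length-node : ∀ k I → WellFormed (suc k) I →
                length (draw (suc k) I) ≤ 126 * (W * scale (suc k)) + total k I
  length-node k I (I≤ , tr≤ , wfs , _) = begin
    length (map (map₁ swap) (columns (63 * s) tr ++ stack k I))
      ≡⟨ trans (List.length-map _ (columns (63 * s) tr ++ stack k I)) (List.length-++ (columns (63 * s) tr)) ⟩
    length (columns (63 * s) tr) + length (stack k I)
      ≤⟨ +-mono-≤ (≤-reflexive (length-columns (63 * s) tr)) (length-stack k I wfs) ⟩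
    length tr * (63 * s) + (length I * (W * W) + total k I)
      ≤⟨ +-mono-≤ (*-monoˡ-≤ (63 * s) tr≤)
           (+-monoˡ-≤ (total k I) (*-mono-≤ I≤ (*-monoʳ-≤ W (W≤scale (suc k))))) ⟩
    W * (63 * s) + (63 * (W * s) + total k I)
      ≡⟨ cong (_+ (63 * (W * s) + total k I)) (x∙yz≈y∙xz *-commutativeSemigroup W 63 s) ⟩
    63 * (W * s) + (63 * (W * s) + total k I)
      ≡⟨ +-assoc (63 * (W * s)) (63 * (W * s)) (total k I) ⟨
    (63 * (W * s) + 63 * (W * s)) + total k I
      ≡⟨ cong (_+ total k I) (*-distribʳ-+ (W * s) 63 63) ⟨
    126 * (W * s) + total k I ∎
    where
    open ≤-Reasoning
    s  = scale (suc k)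
    tr = concatMap proj₂ I

-- From grid minors to voxel representations

Point : Set
Point = Vec ℕ 3

inc : Fin 3 → Point → Point
inc i p = updateAt p i suc

double : Point → Point
double = Vec.map (λ x → x + x)

double-inc : ∀ i p → inc i (inc i (double p)) ≡ double (inc i p)
double-inc i p = trans (Vec.updateAt-updateAt i (double p))
  (sym (Vec.map-updateAt p i (cong suc (+-suc _ _))))

updateAt-injective : ∀ {A : Set} {n} {f : A → A} → (∀ {x y} → f x ≡ f y → x ≡ y) →
                     ∀ (i : Fin n) {p q} → updateAt p i f ≡ updateAt q i f → p ≡ q
updateAt-injective f-inj zero {_ ∷ _} {_ ∷ _} eq =
  cong₂ _∷_ (f-inj (Vec.∷-injectiveˡ eq)) (Vec.∷-injectiveʳ eq)
updateAt-injective f-inj (suc i) {_ ∷ _} {_ ∷ _} eq =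
  cong₂ _∷_ (Vec.∷-injectiveˡ eq) (updateAt-injective f-inj i (Vec.∷-injectiveʳ eq))

map-injective : ∀ {A B : Set} {n} {f : A → B} → (∀ {x y} → f x ≡ f y → x ≡ y) →
                {p q : Vec A n} → Vec.map f p ≡ Vec.map f q → p ≡ q
map-injective f-inj {[]} {[]} eq = refl
map-injective f-inj {_ ∷ _} {_ ∷ _} eq =
  cong₂ _∷_ (f-inj (Vec.∷-injectiveˡ eq)) (map-injective f-inj (Vec.∷-injectiveʳ eq))

inc-injective : ∀ i {p q} → inc i p ≡ inc i q → p ≡ q
inc-injective = updateAt-injective suc-injective

double-injective : ∀ {p q} → double p ≡ double q → p ≡ q
double-injective = map-injective λ {x} {y} eq →
  trans (n≡⌊n+n/2⌋ x) (trans (cong ⌊_/2⌋ eq) (sym (n≡⌊n+n/2⌋ y)))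

odd : ℕ → Bool
odd zero    = false
odd (suc n) = not (odd n)

odd-+ : ∀ n → odd (n + n) ≡ false
odd-+ zero    = refl
odd-+ (suc n) = trans (cong (not ∘ odd) (+-suc n n)) (trans (not-involutive _) (odd-+ n))

par : Point → Fin 3 → Bool
par p k = odd (Vec.lookup p k)

par-double : ∀ p k → par (double p) k ≡ false
par-double p k = trans (cong odd (Vec.lookup-map k _ p)) (odd-+ (Vec.lookup p k))

par-inc : ∀ k p → par (inc k p) k ≡ not (par p k)
par-inc k p = cong odd (Vec.lookup∘updateAt k p)

par-inc′ : ∀ {j k} p → j ≢ k → par (inc k p) j ≡ par p j
par-inc′ p j≢k = cong odd (Vec.lookup∘updateAt′ _ _ j≢k p)

cell : Point → Voxel
cell = Vec.map pos

cell-injective : ∀ {p q} → cell p ≡ cell q → p ≡ q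
cell-injective = map-injective ℤ.+-injective

cell-inc : ∀ i p → cell (inc i p) ≡ shift i (cell p)
cell-inc i p = Vec.map-updateAt p i refl

infix 4 _~_

_~_ : Point → Point → Set
p ~ q = ∃ λ i → q ≡ inc i p ⊎ p ≡ inc i q

~-sym : ∀ {p q} → p ~ q → q ~ p
~-sym (i , r) = i , Sum.swap r

p≢inc : ∀ i {p} → p ≢ inc i p
p≢inc i {p} eq = 1+n≢n (sym (trans (cong (λ q → Vec.lookup q i) eq) (Vec.lookup∘updateAt i p)))

inc⇒adjacent : ∀ i p → Adjacent (cell p) (cell (inc i p))
inc⇒adjacent i p =
  p≢inc i ∘ cell-injective ,
  face i (shift i (cell p)) , upper i _ ,
  subst (λ x → face i x IsFaceOf cell (inc i p)) (cell-inc i p) (lower i _)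

adjacent-sym : ∀ {a b} → Adjacent a b → Adjacent b a
adjacent-sym (a≢b , f , fa , fb) = a≢b ∘ sym , f , fb , fa

~⇒adjacent : ∀ {p q} → p ~ q → Adjacent (cell p) (cell q)
~⇒adjacent (i , inj₁ refl) = inc⇒adjacent i _
~⇒adjacent (i , inj₂ refl) = adjacent-sym (inc⇒adjacent i _)

shift-injective : ∀ i {a b} → shift i a ≡ shift i b → a ≡ b
shift-injective = updateAt-injective λ {x} {y} eq →
  trans (sym (ℤ.pred-suc x)) (trans (cong ℤ.pred eq) (ℤ.pred-suc y))

common-face : ∀ {f a b} → a ≢ b → f IsFaceOf a → f IsFaceOf b →
              ∃ λ i → b ≡ shift i a ⊎ a ≡ shift i b
common-face a≢b (lower i p) (lower .i .p) = ⊥-elim (a≢b refl)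
common-face {b = b} a≢b (lower i ._) (upper .i .b) = i , inj₂ refl
common-face {a = a} {b} a≢b (upper i .a) f = go f refl
  where
  go : ∀ {c} → face i c IsFaceOf b → c ≡ shift i a → ∃ λ i → b ≡ shift i a ⊎ a ≡ shift i b
  go (lower _ _) eq = i , inj₁ eq
  go (upper _ _) eq = ⊥-elim (a≢b (shift-injective i (sym eq)))

adjacent⇒~ : ∀ {p q} → Adjacent (cell p) (cell q) → p ~ q
adjacent⇒~ (p≢q , f , fp , fq) with common-face p≢q fp fq
... | i , inj₁ eq = i , inj₁ (cell-injective (trans eq (sym (cell-inc i _))))
... | i , inj₂ eq = i , inj₂ (cell-injective (trans eq (sym (cell-inc i _))))

sum-bump : ∀ {n} {f g : Fin n → ℕ} a → g a ≡ suc (f a) → (∀ v → a ≢ v → g v ≡ f v) →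
           sum (tabulate g) ≡ suc (sum (tabulate f))
sum-bump {suc n} zero eq eqs =
  cong₂ _+_ eq (cong sum (List.tabulate-cong (λ v → eqs (suc v) λ ())))
sum-bump {suc n} {f} (suc a) eq eqs = trans
  (cong₂ _+_ (eqs zero λ ()) (sum-bump a eq (λ v a≢v → eqs (suc v) (a≢v ∘ Fin.suc-injective))))
  (+-suc (f zero) _)

sum-mono : ∀ {n} c {f g : Fin n → ℕ} → (∀ v → f v ≤ c * g v) →
           sum (tabulate f) ≤ c * sum (tabulate g)
sum-mono {zero}  c f≤g = z≤n
sum-mono {suc n} c {f} {g} f≤g = ≤-trans (+-mono-≤ (f≤g zero) (sum-mono c (f≤g ∘ suc)))
  (≤-reflexive (sym (*-distribˡ-+ c (g zero) _)))

sum-zero : ∀ n → sum (tabulate {n = n} (λ _ → 0)) ≡ 0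
sum-zero zero    = refl
sum-zero (suc n) = sum-zero n

length-deduplicate : ∀ {A : Set} (_≟_ : DecidableEquality A) xs → length (deduplicate _≟_ xs) ≤ length xs
length-deduplicate _≟_ []       = z≤n
length-deduplicate _≟_ (x ∷ xs) =
  s≤s (≤-trans (List.length-filter _ (deduplicate _≟_ xs)) (length-deduplicate _≟_ xs))

length-concatMap : ∀ {A B : Set} c (f : A → List B) → (∀ x → length (f x) ≤ c) →
                   ∀ xs → length (concatMap f xs) ≤ c * length xs
length-concatMap c f f≤c []       = z≤n
length-concatMap c f f≤c (x ∷ xs) = begin
  length (f x ++ concatMap f xs)        ≡⟨ List.length-++ (f x) ⟩
  length (f x) + length (concatMap f xs) ≤⟨ +-mono-≤ (f≤c x) (length-concatMap c f f≤c xs) ⟩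
  c + c * length xs                      ≡⟨ *-suc c _ ⟨
  c * suc (length xs)                    ∎
  where open ≤-Reasoning

module _ {n : ℕ} (G : Graph n) where

  -- Branch sets witnessing that G is a minor of the grid ℕ³.
  record GridMinor (L : List (Point × Fin n)) : Set where
    field
      functional : ∀ {p u v} → (p , u) ∈ L → (p , v) ∈ L → u ≡ v
      inhabited  : ∀ v → ∃ λ p → (p , v) ∈ L
      linked     : ∀ {v p q} → (p , v) ∈ L → (q , v) ∈ L →
                   Star (λ p q → (p , v) ∈ L × (q , v) ∈ L × p ~ q) p q
      touching   : ∀ {u v} → Adj G u v → ∃₂ λ p q → (p , u) ∈ L × (q , v) ∈ L × p ~ q

  module _ {L : List (Point × Fin n)} (M : GridMinor L) where
    open GridMinor M

    -- Doubling the grid separates the branch sets; the midpoints of grid edges then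
    -- restore exactly the contacts that are wanted.
    data Occupies (v : Fin n) : Point → Set where
      at      : ∀ {p} → (p , v) ∈ L → Occupies v (double p)
      between : ∀ {p w} i → (p , v) ∈ L → (inc i p , w) ∈ L → w ≡ v ⊎ Adj G v w →
                Occupies v (inc i (double p))

    par-between : ∀ i p → par (inc i (double p)) i ≡ true
    par-between i p = trans (par-inc i (double p)) (cong not (par-double p i))

    par-between′ : ∀ {i j} p → j ≢ i → par (inc i (double p)) j ≡ false
    par-between′ {j = j} p j≢i = trans (par-inc′ (double p) j≢i) (par-double p j)

    parity-clash : ∀ {a b} k → a ≡ b → par a k ≡ true → par b k ≡ false → ⊥
    parity-clash k refl t f with trans (sym t) f
    ... | ()

    between-axis : ∀ {i j p q} → inc i (double p) ≡ inc j (double q) → i ≡ j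
    between-axis {i} {j} {p} {q} eq with i Fin.≟ j
    ... | yes i≡j = i≡j
    ... | no  i≢j = ⊥-elim (parity-clash i eq (par-between i p) (par-between′ q i≢j))

    between-injective : ∀ {i j p q} → inc i (double p) ≡ inc j (double q) → p ≡ q
    between-injective {p = p} {q} eq with between-axis {p = p} {q} eq
    ... | refl = double-injective (inc-injective _ eq)

    occupies-unique : ∀ {u v a b} → a ≡ b → Occupies u a → Occupies v b → u ≡ v
    occupies-unique eq (at p) (at q) with double-injective eq
    ... | refl = functional p q
    occupies-unique eq (at {p} _) (between {q} i _ _ _) =
      ⊥-elim (parity-clash i (sym eq) (par-between i q) (par-double p i))
    occupies-unique eq (between {p} i _ _ _) (at {q} _) =
      ⊥-elim (parity-clash i eq (par-between i p) (par-double q i))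
    occupies-unique eq (between {p} i m _ _) (between {q} j m′ _ _) with between-injective {p = p} {q} eq
    ... | refl = functional m m′

    -- A doubled point has only even coordinates and a midpoint exactly one odd coordinate, so a
    -- unit step joins a doubled point and a midpoint. Towards its lower end a midpoint meets its
    -- own vertex. Towards its upper end it meets the vertex `w` recorded in `between`, which is
    -- equal or adjacent to its own.
    occupies-inc : ∀ {u v a b} k → inc k a ≡ b → u ≢ v → Occupies u a → Occupies v b → Adj G u v
    occupies-inc k eq u≢v (at {p} _) (at {q} _) =
      ⊥-elim (parity-clash k eq (par-between k p) (par-double q k))
    occupies-inc k eq u≢v (at {p} m) (between {q} j m′ _ _) with between-injective {p = p} {q} eq
    ... | refl = ⊥-elim (u≢v (functional m m′))
    occupies-inc k eq u≢v (between {p} j m o r) (at {q} m′) with k Fin.≟ j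
    ... | no k≢j = ⊥-elim (parity-clash k eq
            (trans (par-inc k (inc j (double p))) (cong not (par-between′ p k≢j))) (par-double q k))
    ... | yes refl with double-injective (trans (sym (double-inc j p)) eq)
    ... | refl with functional o m′ | r
    ... | refl | inj₁ v≡u = ⊥-elim (u≢v (sym v≡u))
    ... | refl | inj₂ adj = adj
    occupies-inc k eq u≢v (between {p} j m o r) (between {q} i m′ _ _) with k Fin.≟ j
    ... | yes refl = ⊥-elim (parity-clash i (trans (sym eq) (double-inc j p)) (par-between i q) (par-double (inc k p) i))
    ... | no k≢j with k Fin.≟ i
    ...   | no k≢i = ⊥-elim (parity-clash k eq
            (trans (par-inc k (inc j (double p))) (cong not (par-between′ p k≢j))) (par-between′ q k≢i))
    ...   | yes refl = ⊥-elim (parity-clash j eq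
            (trans (par-inc′ (inc j (double p)) (k≢j ∘ sym)) (par-between j p)) (par-between′ q (k≢j ∘ sym)))

    occupies-~ : ∀ {u v a b} → a ~ b → u ≢ v → Occupies u a → Occupies v b → Adj G u v
    occupies-~ (k , inj₁ eq) u≢v oa ob = occupies-inc k (sym eq) u≢v oa ob
    occupies-~ (k , inj₂ eq) u≢v oa ob =
      Graph.symmetric G (occupies-inc k (sym eq) (u≢v ∘ sym) ob oa)

    joins? : ∀ v i p → Dec (Any (λ c → proj₁ c ≡ inc i p × (proj₂ c ≡ v ⊎ Adj G v (proj₂ c))) L)
    joins? v i p = Any.any? (λ c → Vec.≡-dec _≟_ (proj₁ c) (inc i p) ×-dec
                                   ((proj₂ c Fin.≟ v) ⊎-dec Graph.adj? G v (proj₂ c))) L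

    cluster : Fin n → Point → List Point
    cluster v p = double p ∷ map (λ i → inc i (double p)) (filter (λ i → joins? v i p) (allFin 3))

    branch : Fin n → List Point
    branch v = map proj₁ (filter (λ c → proj₂ c Fin.≟ v) L)

    -- Repetitions are removed because `L` may list an entry twice, while a blob demands a list
    -- without repetitions.
    points : Fin n → List Point
    points v = deduplicate (Vec.≡-dec _≟_) (concatMap (cluster v) (branch v))

    branch⁺ : ∀ {v p} → (p , v) ∈ L → p ∈ branch v
    branch⁺ m = ∈-map⁺ proj₁ (∈-filter⁺ _ m refl)

    branch⁻ : ∀ {v p} → p ∈ branch v → (p , v) ∈ L
    branch⁻ m with ∈-map⁻ proj₁ m
    ... | _ , m′ , refl with ∈-filter⁻ (λ c → proj₂ c Fin.≟ _) {xs = L} m′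
    ... | c∈L , refl = c∈L

    points⁺ : ∀ {v a} → Occupies v a → a ∈ points v
    points⁺ {v} (at m) = ∈-deduplicate⁺ (Vec.≡-dec _≟_)
      (∈-concatMap⁺ (cluster v) (lose (branch⁺ m) (here refl)))
    points⁺ {v} (between {p} i m o r) = ∈-deduplicate⁺ (Vec.≡-dec _≟_)
      (∈-concatMap⁺ (cluster v) (lose (branch⁺ m)
        (there (∈-map⁺ _ (∈-filter⁺ (λ i → joins? v i p) (∈-allFin i) (lose o (refl , r)))))))

    points⁻ : ∀ {v a} → a ∈ points v → Occupies v a
    points⁻ {v} a∈ with find (∈-concatMap⁻ (cluster v) {xs = branch v} (∈-deduplicate⁻ (Vec.≡-dec _≟_) _ a∈))
    ... | p , p∈ , here refl = at (branch⁻ p∈)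
    ... | p , p∈ , there a∈′ with ∈-map⁻ (λ i → inc i (double p)) a∈′
    ... | i , i∈ , refl with find (proj₂ (∈-filter⁻ (λ i → joins? v i p) {xs = allFin 3} i∈))
    ... | (_ , w) , o , refl , r = between i (branch⁻ p∈) o r

    _⟿[_]_ : Point → Fin n → Point → Set
    a ⟿[ v ] b = Star (λ a b → Occupies v a × Occupies v b × a ~ b) a b

    reverse : ∀ {v a b} → a ⟿[ v ] b → b ⟿[ v ] a
    reverse = Star.reverse λ (oa , ob , a~b) → ob , oa , ~-sym a~b

    double-inc-step : ∀ {v p} i → (p , v) ∈ L → (inc i p , v) ∈ L → double p ⟿[ v ] double (inc i p)
    double-inc-step {p = p} i m m′ =
      let o = between i m m′ (inj₁ refl) in
      (at m , o , i , inj₁ refl) ◅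
      (o , at m′ , i , inj₁ (sym (double-inc i p))) ◅ ε

    double-step : ∀ {v p q} → (p , v) ∈ L → (q , v) ∈ L → p ~ q → double p ⟿[ v ] double q
    double-step m m′ (i , inj₁ refl) = double-inc-step i m m′
    double-step m m′ (i , inj₂ refl) = reverse (double-inc-step i m′ m)

    anchor : ∀ {v a} → Occupies v a → ∃ λ p → (p , v) ∈ L × (a ⟿[ v ] double p)
    anchor (at m) = _ , m , ε
    anchor o@(between i m _ _) = _ , m , (o , at m , i , inj₂ refl) ◅ ε

    occupies-connected : ∀ {v a b} → Occupies v a → Occupies v b → a ⟿[ v ] b
    occupies-connected oa ob =
      let p , m , as = anchor oa
          q , m′ , bs = anchor ob
      in as ◅◅ Star.kleisliStar double (λ (m , m′ , p~q) → double-step m m′ p~q) (linked m m′) ◅◅ reverse bs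

    points-unique : ∀ v → Unique (points v)
    points-unique v = UniqueDec.deduplicate-! (Vec.≡-dec _≟_) _

    blob : Fin n → Blob
    blob v = record
      { voxels    = map cell (points v)
      ; unique    = Unique.map⁺ cell-injective (points-unique v)
      ; nonEmpty  = let p , m = inhabited v in cell (double p) , ∈-map⁺ cell (points⁺ (at m))
      ; connected = connected
      }
      where
      connected : ConnectedIn Adjacent (_∈ map cell (points v))
      connected x∈ y∈ with ∈-map⁻ cell x∈ | ∈-map⁻ cell y∈
      ... | a , a∈ , refl | b , b∈ , refl =
        Star.gmap cell
          (λ (oa , ob , a~b) → ∈-map⁺ cell (points⁺ oa) , ∈-map⁺ cell (points⁺ ob) , ~⇒adjacent a~b)
          (occupies-connected (points⁻ a∈) (points⁻ b∈))

    touching-blobs : ∀ {u v} → Adj G u v → Touching (blob u) (blob v)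
    touching-blobs {u} {v} adj with touching adj
    ... | p , q , m , m′ , i , inj₁ refl =
      cell (inc i (double p)) , cell (double q) ,
      ∈-map⁺ cell (points⁺ (between i m m′ (inj₂ adj))) , ∈-map⁺ cell (points⁺ (at m′)) ,
      ~⇒adjacent (i , inj₁ (sym (double-inc i p)))
    ... | p , q , m , m′ , i , inj₂ refl =
      cell (double p) , cell (inc i (double q)) ,
      ∈-map⁺ cell (points⁺ (at m)) , ∈-map⁺ cell (points⁺ (between i m′ m (inj₂ (Graph.symmetric G adj)))) ,
      ~⇒adjacent (i , inj₂ (sym (double-inc i q)))

    touching⇒adj : ∀ {u v} → u ≢ v → Touching (blob u) (blob v) → Adj G u v
    touching⇒adj u≢v (x , y , x∈ , y∈ , adj) with ∈-map⁻ cell x∈ | ∈-map⁻ cell y∈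
    ... | a , a∈ , refl | b , b∈ , refl =
      occupies-~ (adjacent⇒~ adj) u≢v (points⁻ a∈) (points⁻ b∈)

    representation : VoxelRepresentation G
    representation = record
      { blob     = blob
      ; disjoint = λ u≢v (x∈ , y∈) → u≢v (same-owner x∈ y∈)
      ; contact  = λ u≢v → mk⇔ (touching⇒adj u≢v) touching-blobs
      }
      where
      same-owner : ∀ {u v x} → x ∈ voxels (blob u) → x ∈ voxels (blob v) → u ≡ v
      same-owner x∈ y∈ with ∈-map⁻ cell x∈ | ∈-map⁻ cell y∈
      ... | a , a∈ , refl | b , b∈ , eq =
        occupies-unique (cell-injective eq) (points⁻ a∈) (points⁻ b∈)

    -- A midpoint is charged to its lower end, so a grid point answers for its double and at most
    -- one midpoint per axis.
    length-cluster : ∀ v p → length (cluster v p) ≤ 4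
    length-cluster v p = s≤s (≤-trans (≤-reflexive (List.length-map _ (filter (λ i → joins? v i p) (allFin 3))))
      (List.length-filter (λ i → joins? v i p) (allFin 3)))

    sum-branches : ∀ (K : List (Point × Fin n)) →
      sum (tabulate (λ v → length (map proj₁ (filter (λ c → proj₂ c Fin.≟ v) K)))) ≡ length K
    sum-branches [] = sum-zero n
    sum-branches ((p , a) ∷ K) = trans
      (sum-bump a (cong (length ∘ map proj₁) (List.filter-accept (λ c → proj₂ c Fin.≟ a) {p , a} {K} refl))
        (λ v a≢v → cong (length ∘ map proj₁) (List.filter-reject (λ c → proj₂ c Fin.≟ v) {p , a} {K} a≢v)))
      (cong suc (sum-branches K))

    size-representation : size representation ≤ 4 * length L
    size-representation = ≤-trans (sum-mono 4 bound) (*-monoʳ-≤ 4 (≤-reflexive (sum-branches L)))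
      where
      bound : ∀ v → length (map cell (points v)) ≤ 4 * length (branch v)
      bound v = begin
        length (map cell (points v))                 ≡⟨ List.length-map cell (points v) ⟩
        length (points v)                            ≤⟨ length-deduplicate (Vec.≡-dec _≟_) (concatMap (cluster v) (branch v)) ⟩
        length (concatMap (cluster v) (branch v))    ≤⟨ length-concatMap 4 (cluster v) (length-cluster v) (branch v) ⟩
        4 * length (branch v)                        ∎
        where open ≤-Reasoning

-- Assembly

module _ {n : ℕ} (G : Graph n) (K W : ℕ) (189K≤W : 63 * (3 * K) ≤ W) where

  open Trees (Fin n) K
  open Drawing (Fin._≟_ {n}) W

  cells : ∀ k → Hier k → ℕ
  cells k x = length (draw k x)

  -- Bounds the cells that a unit of level `k` contributes beyond those of its children.
  wiring : ℕ → ℕ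
  wiring k = 126 * (W * scale k)

  record Complete (k : ℕ) (t : Tree (Hier k)) : Set where
    field
      separated  : Separated (λ v x → Occ v k x) (tracks k) (λ _ → ⊥) t
      wellFormed : AllT (λ _ → WellFormed k) t
      occurs     : ∀ v → AnyT (Occ v k) t
      together   : ∀ {u v} → Adj G u v → AnyT (Together u v k) t

  module _ {k : ℕ} {t : Tree (Hier k)} (C : Complete k t) where
    open Complete C
    -- Every unit weighs 1. The threshold 31 makes a cluster consist of at most 1 + 31 + 31 = 63
    -- units, and by `finish-few` the number of clusters is at most 2/32 of the number of units,
    -- unless it is at most 1.
    open Contraction {X = Hier k} (λ v x → Occ v k x) (tracks k) (λ _ → 1) 31 hiding (Coherent)

    length-sumI : ∀ I → sumI (λ _ → 1) I ≡ length I
    length-sumI []      = refl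
    length-sumI (_ ∷ I) = cong suc (length-sumI I)

    length-ports : ∀ {I : Items} {c} → All (λ y → length (proj₂ y) ≤ c) I → length (ports I) ≤ length I * c
    length-ports [] = z≤n
    length-ports {(_ , P) ∷ I} (p ∷ ps) = ≤-trans (≤-reflexive (List.length-++ P)) (+-mono-≤ p (length-ports ps))

    -- At most 63 items with at most `3 * K` ports each have to fit among the `W` tracks, whence the
    -- factor 189 between `W` and `K`.
    good⇒wellFormed : ∀ {I} → wI I ≤ 63 → All (λ y → WellFormed k (proj₁ y)) I → Good I → WellFormed (suc k) I
    good⇒wellFormed {I} wI≤ wf (good , coh) =
      I≤ ,
      ≤-trans (length-ports (All.map proj₂ good)) (≤-trans (*-monoˡ-≤ (3 * K) I≤) 189K≤W) ,
      All.zip (wf , All.map proj₁ good) ,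
      coh
      where
      I≤ : length I ≤ 63
      I≤ = ≤-trans (≤-reflexive (sym (length-sumI I))) wI≤

    coarsen : ∃ λ t′ → Complete (suc k) t′ ×
              weigh (cells (suc k)) t′ ≤ count t′ * wiring (suc k) + weigh (cells k) t ×
              (count t′ ≤ 1 ⊎ count t′ * 32 ≤ 2 * count t)
    coarsen with contract t
    ... | I , t′ , c = finish (top t) I t′ ,
      record { separated  = finish-separated c separated
             ; wellFormed = wf
             ; occurs     = λ v → finish⁺ c (occurs v)
             ; together   = λ {u} {v} adj → finish⁺ c (together adj) } ,
      ≤-trans (weigh-bound (wiring (suc k)) (mapAllT (length-node k _) wf))
        (≤-reflexive (cong (count (finish (top t) I t′) * wiring (suc k) +_) (weigh-finish c (cells k)))) ,
      Sum.map₂ (λ p → ≤-trans p (≤-reflexive (cong (2 *_) (weigh-1 t)))) (finish-few c)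
      where
      inv = invariant c separated

      light : wI I ≤ 63
      light = ≤-trans (items-light c) (m≤m+n 31 32)

      wf : AllT (λ _ → WellFormed (suc k)) (finish (top t) I t′)
      wf = finish-all c {P = λ _ → WellFormed (suc k)}
        (good⇒wellFormed light (proj₁ (all⁺ c wellFormed)) (Invariant.good inv))
        (zipAllT (λ wI≤ (wf , good) → good⇒wellFormed wI≤ wf good)
          (rest-light c (trivial t))
          (zipAllT _,_ (proj₂ (all⁺ c wellFormed)) (Invariant.goods inv)))
        where
        trivial : ∀ t → AllT (λ _ _ → 1 ≤ 1) t
        trivial nil            = nil
        trivial (node _ _ l r) = node ≤-refl (trivial l) (trivial r)

  record Drawable (B : ℕ) : Set where
    field
      level      : ℕ
      unit       : Hier level
      wellFormed : WellFormed level unit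
      occurs     : ∀ v → Occ v level unit
      together   : ∀ {u v} → Adj G u v → Together u v level unit
      cells≤     : cells level unit ≤ B

  single : ∀ {k t B} → Fin n → Complete k t → count t ≤ 1 → weigh (cells k) t ≤ B → Drawable B
  single {t = nil} v C _ _ with () ← Complete.occurs C v
  single {t = node S x (node _ _ _ _) r} v C (s≤s ()) _
  single {t = node S x nil (node _ _ _ _)} v C (s≤s ()) _
  single {k} {node S x nil nil} v C _ ≤B with Complete.wellFormed C
  ... | node wf _ _ = record
    { level      = k
    ; unit       = x
    ; wellFormed = wf
    ; occurs     = λ v → root (Complete.occurs C v)
    ; together   = λ {u} {v} adj → root (Complete.together C adj)
    ; cells≤     = ≤-trans (≤-reflexive (sym (+-identityʳ (cells k x)))) ≤B
    }
    where
    root : ∀ {Q} → AnyT Q (node S x nil nil) → Q x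
    root (here q) = q

  nonempty : ∀ {k t} → Fin n → Complete k t → 1 ≤ count t
  nonempty {t = nil} v C with () ← Complete.occurs C v
  nonempty {t = node _ _ _ _} v C = s≤s z≤n

  wiring-suc : ∀ k → wiring (suc k) ≡ 8 * wiring k
  wiring-suc k = rearrange 126 W 8 (scale k)
    where
    rearrange : ∀ a b c d → a * (b * (c * d)) ≡ c * (a * (b * d))
    rearrange = solve-∀

  -- The potential weigh (cells k) t + count t * wiring k does not increase: a level multiplies
  -- the wiring of a unit by 8 but divides the number of units by 16.
  iterate : ∀ fuel {k t B} → Fin n → Complete k t → count t ≤ fuel →
            weigh (cells k) t + count t * wiring k ≤ B → Drawable (8 * B)
  iterate zero v C t≤ _ = ⊥-elim (<⇒≱ (nonempty v C) t≤)
  iterate (suc f) {k} {t} {B} v C t≤ ≤B with coarsen C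
  ... | t′ , C′ , cells′ , few = continue (count t′ ≤? 1) few
    where
    open ≤-Reasoning
    N  = count t
    N′ = count t′
    w  = wiring k
    c  = weigh (cells k) t

    continue : Dec (N′ ≤ 1) → N′ ≤ 1 ⊎ N′ * 32 ≤ 2 * N → Drawable (8 * B)
    -- In the last round the number of units need not drop by 16, so the factor 8 in the wiring is
    -- not compensated. It is paid once, as the 8 in `8 * B`.
    continue (yes N′≤1) _ = single v C′ N′≤1 (begin
      weigh (cells (suc k)) t′       ≤⟨ cells′ ⟩
      N′ * wiring (suc k) + c        ≡⟨ cong (λ z → N′ * z + c) (wiring-suc k) ⟩
      N′ * (8 * w) + c               ≤⟨ +-mono-≤ (*-monoˡ-≤ (8 * w) (≤-trans N′≤1 (nonempty v C))) (m≤m+n c _) ⟩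
      N * (8 * w) + 8 * c            ≡⟨ factor 8 N w c ⟩
      8 * (c + N * w)                ≤⟨ *-monoʳ-≤ 8 ≤B ⟩
      8 * B                          ∎)
      where
      factor : ∀ e N w c → N * (e * w) + e * c ≡ e * (c + N * w)
      factor = solve-∀
    continue (no N′≰1) (inj₁ N′≤1) = ⊥-elim (N′≰1 N′≤1)
    continue (no N′≰1) (inj₂ p) = iterate f v C′ (s≤s⁻¹ (≤-trans N′<N t≤)) (begin
      weigh (cells (suc k)) t′ + N′ * wiring (suc k)  ≤⟨ +-monoˡ-≤ (N′ * wiring (suc k)) cells′ ⟩
      N′ * wiring (suc k) + c + N′ * wiring (suc k)   ≡⟨ cong (λ z → N′ * z + c + N′ * z) (wiring-suc k) ⟩
      N′ * (8 * w) + c + N′ * (8 * w)                 ≡⟨ regroup N′ w c ⟩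
      c + N′ * 16 * w                                 ≤⟨ +-monoʳ-≤ c (*-monoˡ-≤ w N′≤) ⟩
      c + N * w                                       ≤⟨ ≤B ⟩
      B                                               ∎)
      where
      regroup : ∀ N w c → N * (8 * w) + c + N * (8 * w) ≡ c + N * 16 * w
      regroup = solve-∀

      halve : ∀ N → N * 32 ≡ 2 * (N * 16)
      halve = solve-∀

      N′≤ : N′ * 16 ≤ N
      N′≤ = *-cancelˡ-≤ 2 (≤-trans (≤-reflexive (sym (halve N′))) p)

      N′<N : N′ < N
      N′<N = begin
        suc N′       ≤⟨ s≤s (m≤n+m N′ 0) ⟩
        1 + N′       ≤⟨ +-monoˡ-≤ N′ (<⇒≤ (≰⇒> N′≰1)) ⟩
        N′ + N′      ≡⟨ cong (N′ +_) (+-identityʳ N′) ⟨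
        2 * N′       ≡⟨ *-comm 2 N′ ⟩
        N′ * 2       ≤⟨ *-monoʳ-≤ N′ (m≤m+n 2 14) ⟩
        N′ * 16      ≤⟨ N′≤ ⟩
        N            ∎

  point : Cell → Point
  point (x , y , b) = x ∷ y ∷ (if b then 1 else 0) ∷ []

  point-injective : ∀ {c d} → point c ≡ point d → c ≡ d
  point-injective {x , y , false} {x′ , y′ , false} refl = refl
  point-injective {x , y , true}  {x′ , y′ , true}  refl = refl

  ↝⇒~ : ∀ {c d} → c ↝ d → point c ~ point d
  ↝⇒~ east  = zero , inj₁ refl
  ↝⇒~ north = suc zero , inj₁ refl
  ↝⇒~ via   = suc (suc zero) , inj₁ refl

  ≈⇒~ : ∀ {c d} → c ≈ d → point c ~ point d
  ≈⇒~ (inj₁ s) = ↝⇒~ s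
  ≈⇒~ (inj₂ s) = ~-sym (↝⇒~ s)

  module _ {B : ℕ} (D : Drawable B) where
    open Drawable D

    painting : List (Point × Fin n)
    painting = map (map₁ point) (draw level unit)

    painting⁺ : ∀ {c v} → Drawn level unit c v → (point c , v) ∈ painting
    painting⁺ m = ∈-map⁺ (map₁ point) (∈-draw⁺ m)

    painting⁻ : ∀ {p v} → (p , v) ∈ painting → ∃ λ c → p ≡ point c × Drawn level unit c v
    painting⁻ m with ∈-map⁻ (map₁ point) m
    ... | (c , _) , m′ , refl = c , refl , ∈-draw⁻ level unit m′

    painting-minor : GridMinor G painting
    painting-minor = record
      { functional = functional
      ; inhabited  = λ v → let c , m = drawn-inhabited level unit wellFormed (occurs v) in point c , painting⁺ m
      ; linked     = linked
      ; touching   = λ adj → let c , d , m , m′ , c≈d = drawn-touching level unit (together adj) in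
                       point c , point d , painting⁺ m , painting⁺ m′ , ≈⇒~ c≈d
      }
      where
      functional : ∀ {p u v} → (p , u) ∈ painting → (p , v) ∈ painting → u ≡ v
      functional m m′ with painting⁻ m | painting⁻ m′
      ... | c , eq , d | c′ , eq′ , d′ =
        drawn-unique level unit wellFormed (point-injective (trans (sym eq) eq′)) d d′

      linked : ∀ {v p q} → (p , v) ∈ painting → (q , v) ∈ painting →
               Star (λ p q → (p , v) ∈ painting × (q , v) ∈ painting × p ~ q) p q
      linked m m′ with painting⁻ m | painting⁻ m′
      ... | c , refl , d | c′ , refl , d′ =
        Star.gmap point (λ (e , e′ , c≈c′) → painting⁺ e , painting⁺ e′ , ≈⇒~ c≈c′)
          (drawn-linked level unit wellFormed d d′)

    drawable⇒representation : Σ (VoxelRepresentation G) λ R → size R ≤ 4 * B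
    drawable⇒representation = representation G painting-minor ,
      ≤-trans (size-representation G painting-minor)
        (*-monoʳ-≤ 4 (≤-trans (≤-reflexive (List.length-map (map₁ point) (draw level unit))) cells≤))

  module _ (D : TreeDecomposition G) (bags≤ : ∀ t → ∣ TreeDecomposition.bag D t ∣ ≤ K)
           (τ : ℕ) (K≡ : K ≡ suc τ) where
    open TreeDecomposition D hiding (width)
    open Contraction {X = Label G D K bags≤} (Occurs G D K bags≤) (vertices G D K bags≤) (load G D K bags≤) τ

    module _ {root vis} (T : Grown G D K bags≤ root vis) (all∈ : ∀ t → t ∈ vis) where
      open Grown T

      own : Label G D K bags≤ → List (Fin n)
      own = proj₂

      occI? : ∀ v I → Dec (OccI v I)
      occI? v = Any.any? λ y → v ∈? vertices G D K bags≤ (proj₁ y)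
        where open DecMembership (Fin._≟_ {n}) using (_∈?_)

      -- The filter yields `occ⁻` at once: neither the introduced lists nor `S` are by themselves
      -- known to occur in `I`.
      chunk : List (Fin n) → Items → List (Fin n)
      chunk S I = filter (λ v → occI? v I) (owns own id I ++ S)

      total-load≤n : weigh (load G D K bags≤) grown ≤ n
      total-load≤n = ≤-trans (≤-reflexive total-load) (unique-length distinct)

      length-owns : ∀ I → length (owns own id I) ≡ wI I
      length-owns []      = refl
      length-owns (y ∷ I) = trans (List.length-++ (proj₂ (proj₁ y))) (cong (length (proj₂ (proj₁ y)) +_) (length-owns I))

      open Relabelling OccI ports (λ v T → v ∈ T) id chunk

      open Faithful

      -- A heavy cluster introduces more than `τ`, hence at least `K`, vertices, while all loads add
      -- up to at most `n`; this bounds the number of chunks. Each bag ends up inside one chunk, so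
      -- vertices and edges stay covered.
      base : ∃ λ t → Complete 0 t × (count t * K ≤ 2 * n ⊎ count t ≤ 1)
      base with contract grown
      ... | I , t′ , c = mapT t ,
        record { separated  = separated-mapT faithful sepᵗ
               ; wellFormed = all-mapT
                   (zipAllT (λ {S} {J} → short {S} {J}) (finish-all c (≤-trans (items-light c) (m≤n+m τ (K + τ))) light)
                                  (separated-small OccI ports t sepᵗ))
               ; occurs     = λ v → let s , v∈s = coversVertices v in
                   any-mapT⁺ (mapAllT (λ f → occ⁺ f {v}) faithful)
                     (finish⁺ c {Occurs G D K bags≤ v} (mapAnyT (λ {x} eq → located x eq v∈s) (holds (all∈ s))))
               ; together   = λ {u} {v} adj → let s , u∈s , v∈s = coversEdges adj in
                   any-mapT⁺ (mapAllT (λ {S} {J} → both {S} {J}) faithful)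
                     (finish⁺ c {λ x → Occurs G D K bags≤ u x × Occurs G D K bags≤ v x}
                       (mapAnyT (λ {x} eq → located x eq u∈s , located x eq v∈s) (holds (all∈ s)))) } ,
        Sum.swap (Sum.map (≤-trans (≤-reflexive size≡)) heavy (finish-few c))
        where
        t = finish (top grown) I t′
        sepᵗ = finish-separated c separated
        inv  = invariant c separated

        size≡ : count (mapT t) ≡ count t
        size≡ = count-mapT t

        heavy : count t * suc τ ≤ 2 * weigh (load G D K bags≤) grown →
                count (mapT t) * K ≤ 2 * n
        heavy p = ≤-trans (≤-reflexive (cong₂ _*_ size≡ K≡)) (≤-trans p (*-monoʳ-≤ 2 total-load≤n))

        light : AllT (λ _ J → wI J ≤ K + τ + τ) t′
        light = mapAllT (λ p → ≤-trans p (≤-reflexive (sym (+-assoc K τ τ)))) (rest-light c loads)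

        located : ∀ x {s v} → proj₁ x ≡ s → v ∈ₛ bag s → Occurs G D K bags≤ v x
        located _ refl v∈s = ∈-elements⁺ v∈s

        ports⇒occ′ : ∀ {J} → Good J → ∀ {v} → v ∈ ports J → OccI v J
        ports⇒occ′ ((P⊆ , _) ∷ good , _ ∷ coh) {v} v∈ with ∈-++⁻ _ v∈
        ... | inj₁ v∈P = here (P⊆ v∈P)
        ... | inj₂ v∈J = there (ports⇒occ′ (good , coh) v∈J)

        faithful : AllT (Faithful) t
        faithful = zipAllT faith
          (finish-all c (Invariant.good inv) (Invariant.goods inv))
          (finish-all c {P = OwnedI own id} (owned-items own id c separated introduces) (owned-rest own id c separated introduces))
          where
          faith : ∀ {S J} → Good J → OwnedI own id S J → Faithful S J
          faith {S} {J} good owned = record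
            { occ⁺ = λ o → ∈-filter⁺ (λ v → occI? v J) (owned o) o
            ; occ⁻ = λ v∈ → proj₂ (∈-filter⁻ (λ v → occI? v J) {xs = owns own id J ++ S} v∈)
            ; tr⊆  = λ v∈ → let o = ports⇒occ′ good v∈ in ∈-filter⁺ (λ v → occI? v J) (owned o) o }

        both : ∀ {S J u v} → Faithful S J →
               Any (λ y → Occurs G D K bags≤ u (proj₁ y) × Occurs G D K bags≤ v (proj₁ y)) J →
               u ∈ chunk S J × v ∈ chunk S J
        both f a = occ⁺ f (Any.map proj₁ a) , occ⁺ f (Any.map proj₂ a)

        short : ∀ {S J} → wI J ≤ K + τ + τ → length S ≤ K → length (chunk S J) ≤ W
        short {S} {J} J≤ S≤ = begin
          length (chunk S J)              ≤⟨ List.length-filter (λ v → occI? v J) (owns own id J ++ S) ⟩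
          length (owns own id J ++ S)     ≡⟨ trans (List.length-++ (owns own id J)) (cong (_+ length S) (length-owns J)) ⟩
          -- The root bag of a cluster introduces at most `K` vertices, the open parts on its two
          -- sides at most `τ` each, and the adhesion adds at most `K`.
          wI J + length S                 ≤⟨ +-mono-≤ (≤-trans J≤ (+-mono-≤ (+-monoʳ-≤ K τ≤K) τ≤K)) S≤ ⟩
          K + K + K + K                   ≡⟨ four K ⟩
          4 * K                           ≤⟨ *-monoˡ-≤ K (m≤m+n 4 185) ⟩
          189 * K                         ≡⟨ *-assoc 63 3 K ⟩
          63 * (3 * K)                    ≤⟨ 189K≤W ⟩
          W                               ∎
          where
          open ≤-Reasoning
          τ≤K : τ ≤ K
          τ≤K = ≤-trans (n≤1+n τ) (≤-reflexive (sym K≡))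
          four : ∀ K → K + K + K + K ≡ 4 * K
          four = solve-∀

  weigh-leaves : ∀ {t} → Complete 0 t → weigh (cells 0) t ≤ count t * wiring 0
  weigh-leaves {t} C = ≤-trans
    (weigh-bound {f = cells 0} {g = λ _ → 0} (wiring 0)
      (mapAllT (λ {_} {T} wf → ≤-trans (length-leaf T wf) (m≤m+n _ 0)) (Complete.wellFormed C)))
    (≤-reflexive (trans (cong (count t * wiring 0 +_) (weigh-0 t)) (+-identityʳ _)))
    where
    weigh-0 : ∀ {X : Set} (t : Tree X) → weigh (λ _ → 0) t ≡ 0
    weigh-0 nil            = refl
    weigh-0 (node _ _ l r) = cong₂ _+_ (weigh-0 l) (weigh-0 r)

module _ {n τ : ℕ} (G : Graph n) (n≥1 : n ≥ 1) (τ≥1 : τ ≥ 1)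
         (D : TreeDecomposition G) (width≡ : width D ≡ τ) where
  open TreeDecomposition D hiding (width)

  max≡ : max 0 (tabulate (λ t → ∣ bag t ∣)) ≡ suc τ
  max≡ = unpred width≡ τ≥1
    where
    unpred : ∀ {m τ} → pred m ≡ τ → τ ≥ 1 → m ≡ suc τ
    unpred {zero}  refl ()
    unpred {suc m} refl _ = refl

  bag≤ : ∀ t → ∣ bag t ∣ ≤ suc τ
  bag≤ t = ≤-trans (All.lookup (xs≤max 0 (tabulate (λ t → ∣ bag t ∣))) (∈-tabulate⁺ t)) (≤-reflexive max≡)

  -- A largest bag has `suc τ` distinct vertices. This lets a lone chunk, however light, satisfy the
  -- same bound `2 * n` as many heavy ones.
  suc-τ≤n : suc τ ≤ n
  suc-τ≤n = ≤-trans (≤-reflexive (sym max≡)) (max≤v⁺ z≤n (All.tabulate⁺ (λ t → ∣p∣≤n (bag t))))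

  -- The factors are: `a` voxels per cell, `b` for the last round, 2 for leaves and wiring together,
  -- `c` in the wiring, and `d` as the ratio of `W` to `K`, which enters squared. The final 4
  -- combines `N * K ≤ 2 * n` with `K ≤ 2 * τ`, the latter because `τ ≥ 1`.
  treewidth-bound : ∀ a b c d {K W N C} → C ≡ a * (b * (2 * (c * (d * d * 4)))) →
                    K ≡ suc τ → W ≡ d * K → N * K ≤ 2 * n →
                    a * (b * (N * (c * (W * W)) + N * (c * (W * W)))) ≤ C * n * τ
  treewidth-bound a b c d {K} {N = N} refl refl refl N≤ = begin
    a * (b * (N * (c * (d * K * (d * K))) + N * (c * (d * K * (d * K)))))
      ≡⟨ gather a b c d K N ⟩
    a * (b * (2 * (c * (d * d * (N * K * K)))))
      ≤⟨ *-monoʳ-≤ a (*-monoʳ-≤ b (*-monoʳ-≤ 2 (*-monoʳ-≤ c (*-monoʳ-≤ (d * d) (*-mono-≤ N≤ K≤))))) ⟩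
    a * (b * (2 * (c * (d * d * (2 * n * (2 * τ))))))
      ≡⟨ spread a b c d n τ ⟩
    a * (b * (2 * (c * (d * d * 4)))) * n * τ ∎
    where
    open ≤-Reasoning
    K≤ : K ≤ 2 * τ
    K≤ = ≤-trans (+-monoˡ-≤ τ τ≥1) (≤-reflexive (cong (τ +_) (sym (+-identityʳ τ))))
    gather : ∀ a b c d K N → a * (b * (N * (c * (d * K * (d * K))) + N * (c * (d * K * (d * K))))) ≡
                             a * (b * (2 * (c * (d * d * (N * K * K)))))
    gather = solve-∀
    spread : ∀ a b c d n τ → a * (b * (2 * (c * (d * d * (2 * n * (2 * τ)))))) ≡
                             a * (b * (2 * (c * (d * d * 4)))) * n * τ
    spread = solve-∀

  -- C, K and W stay variables, since products with large literals would be unfolded.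
  module _ {C K W : ℕ} (C≡ : C ≡ 4 * (8 * (2 * (126 * (189 * 189 * 4)))))
           (K≡ : K ≡ suc τ) (W≡ : W ≡ 189 * K) where
    open Trees (Fin n) K using (count)

    W≤ : 63 * (3 * K) ≤ W
    W≤ = ≤-reflexive (trans (sym (*-assoc 63 3 K)) (sym W≡))

    bags≤ : ∀ t → ∣ bag t ∣ ≤ K
    bags≤ t = ≤-trans (bag≤ t) (≤-reflexive (sym K≡))

    complete⇒representation : ∀ {t} → Complete G K W W≤ 0 t → count t * K ≤ 2 * n ⊎ count t ≤ 1 →
                              Σ (VoxelRepresentation G) λ R → size R ≤ C * n * τ
    complete⇒representation {t} c few =
      let R , R≤ = drawable⇒representation G K W W≤ drawing in
      R , ≤-trans R≤ (treewidth-bound 4 8 126 189 {N = count t} C≡ K≡ W≡ (N≤ few))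
      where
      N≤ : count t * K ≤ 2 * n ⊎ count t ≤ 1 → count t * K ≤ 2 * n
      N≤ (inj₁ p)   = p
      N≤ (inj₂ N≤1) = ≤-trans (*-mono-≤ N≤1 (≤-trans (≤-reflexive K≡) suc-τ≤n)) (*-monoˡ-≤ n (n≤1+n 1))

      w = wiring G K W W≤ 0

      drawing : Drawable G K W W≤ (8 * (count t * w + count t * w))
      drawing = iterate G K W W≤ (count t) (Fin.fromℕ< n≥1) c ≤-refl (+-monoˡ-≤ (count t * w) (weigh-leaves G K W W≤ c))

    treewidth-representation : Σ (VoxelRepresentation G) λ R → size R ≤ C * n * τ
    treewidth-representation =
      let _ , grown , all∈ = grow G D K bags≤ (suc nodes) (sprout G D K bags≤ (first (IsTree.nonEmpty isTree)))
                               (m≤m+n (suc nodes) 1)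
          _ , c , few = base G K W W≤ D bags≤ τ K≡ grown all∈
      in complete⇒representation c few
      where
      first : ∀ {m} → NonZero m → Fin m
      first {suc _} _ = zero

theorem11 : ∃ λ (C : ℕ) → C > 0 × ((n τ : ℕ) → n ≥ 1 → τ ≥ 1 →
    (G : Graph n) → HasTreewidth G τ →
    Σ (VoxelRepresentation G) λ R → size R ≤ C * n * τ)
theorem11 = 4 * (8 * (2 * (126 * (189 * 189 * 4)))) , z<s , λ n τ n≥1 τ≥1 G tw →
  let D , width≡ = HasTreewidth.attained tw in treewidth-representation G n≥1 τ≥1 D width≡ refl refl refl
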